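{- Let $\Gamma$ be a context of PHOML in which no term variables are declared. 1. If $\Gamma \vdash \delta : \bot$ then $\delta$ reduces to a neutral proof. 2. If $\Gamma \vdash \delta : \varphi \supset \psi$ then $\delta$ reduces either to a neutral proof, or to a proof $\lambda p{:}\varphi'.\epsilon$ where $\varphi \simeq \varphi'$ and $\Gamma, p : \varphi \vdash \epsilon : \psi$. 3. If $\Gamma \vdash P : \varphi =_\Omega \psi$ then $P$ reduces either to a neutral path; or to $\mathrm{ref}(\chi)$ where $\varphi \simeq \psi \simeq \chi$; or to $\mathrm{univ}_{\varphi',\psi'}(\delta,\epsilon)$ where $\varphi \simeq \varphi'$, $\psi \simeq \psi'$, $\Gamma \vdash \delta : \varphi \supset \psi$ and $\Gamma \vdash \epsilon : \psi \supset \varphi$. 4. If $\Gamma \vdash P : M =_{A \to B} M'$ then $P$ reduces either to a neutral path; or to $\mathrm{ref}(N)$ where $M \simeq M' \simeq N$; or to $\lambda\!\!\lambda\!\!\lambda e{:}x=_A y.Q$ where $\Gamma, x : A, y : A, e : x =_A y \vdash Q : Mx =_B M'y$.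
   Context: **Syntax.** Fix three pairwise disjoint infinite sets of variables: term variables ($x,y$), proof variables ($p,q$), path variables ($e$); $z$ denotes a variable of any kind. Types: $A,B,C ::= \Omega \mid A\to B$. Terms: $L,M,N,\varphi,\psi,\chi ::= x\mid\bot\mid\varphi\supset\psi\mid\lambda x{:}A.M\mid MN$. Proofs: $\delta,\epsilon ::= p\mid\lambda p{:}\varphi.\delta\mid\delta\epsilon\mid P^+\mid P^-$. Paths: $P,Q ::= e\mid \mathrm{ref}(M)\mid P\supset^*Q\mid\mathrm{univ}_{\varphi,\psi}(\delta,\epsilon)\mid \lambda\!\!\lambda\!\!\lambda e{:}x=_Ay.P\mid P_{MN}Q$. Contexts: $\Gamma ::= \langle\rangle\mid\Gamma,x:A\mid\Gamma,p:\varphi\mid\Gamma,e:M=_AN$, the declared variables being distinct. Greek and Roman letters both range over terms, with no formal difference. In $\lambda x{:}A.M$, $x$ is bound in $M$; in $\lambda p{:}\varphi.\delta$, $p$ is bound in $\delta$; in $\lambda\!\!\lambda\!\!\lambda e{:}x=_Ay.P$ the variables $x\not\equiv y$ and $e$ are bound in $P$. Expressions are identified up to $\alpha$-conversion ($\equiv$ is identity); $E[z:=F]$ and $E[\vec z:=\vec F]$ are capture-avoiding (simultaneous) substitution. **Path substitution.** For a term $L$, distinct term variables $\vec x=x_1,\dots,x_n$ ($n\ge 0$), paths $\vec P$ and terms $\vec M,\vec N$, the path $L\{\vec x:=\vec P:\vec M=\vec N\}$, abbreviated $L\{*\}$, is defined by: $x_i\{*\}=P_i$; $y\{*\}=\mathrm{ref}(y)$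 for $y\notin\vec x$; $\bot\{*\}=\mathrm{ref}(\bot)$; $(LL')\{*\}=L\{*\}_{L'[\vec x:=\vec M]\,L'[\vec x:=\vec N]}L'\{*\}$; $(\lambda y{:}A.L)\{*\}=\lambda\!\!\lambda\!\!\lambda e{:}a=_Aa'.\,L\{\vec x:=\vec P:\vec M=\vec N,\;y:=e:a=a'\}$ ($e,a,a'$ fresh); $(\varphi\supset\psi)\{*\}=\varphi\{*\}\supset^*\psi\{*\}$. **Reduction** $\to$ (call-by-name) is inductively defined by the following. Terms: $(\lambda x{:}A.M)N\to M[x:=N]$; $MN\to M'N$ if $M\to M'$; $\varphi\supset\psi\to\varphi'\supset\psi$ if $\varphi\to\varphi'$; $\varphi\supset\psi\to\varphi\supset\psi'$ if $\psi\to\psi'$. Proofs: $(\lambda p{:}\varphi.\delta)\epsilon\to\delta[p:=\epsilon]$; $\mathrm{ref}(\varphi)^+\to\lambda p{:}\varphi.p$; $\mathrm{ref}(\varphi)^-\to\lambda p{:}\varphi.p$; $\mathrm{univ}_{\varphi,\psi}(\delta,\epsilon)^+\to\delta$; $\mathrm{univ}_{\varphi,\psi}(\delta,\epsilon)^-\to\epsilon$; $\delta\epsilon\to\delta'\epsilon$ if $\delta\to\delta'$; $P^+\to Q^+$ and $P^-\to Q^-$ if $P\to Q$. Paths: $(\lambda\!\!\lambda\!\!\lambda e{:}x=_Ay.P)_{MN}Q\to P[x:=M,y:=N,e:=Q]$; $\mathrm{ref}(\lambda x{:}A.M)_{NN'}P\to M\{x:=P:N=N'\}$; $\mathrm{ref}(\varphi)\supset^*\mathrm{ref}(\psi)\to\mathrm{ref}(\varphi\supset\psi)$;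 $\mathrm{ref}(\varphi)\supset^*\mathrm{univ}_{\psi,\chi}(\delta,\epsilon)\to\mathrm{univ}_{\varphi\supset\psi,\varphi\supset\chi}(\lambda p{:}\varphi\supset\psi.\lambda q{:}\varphi.\delta(pq),\ \lambda p{:}\varphi\supset\chi.\lambda q{:}\varphi.\epsilon(pq))$; $\mathrm{univ}_{\varphi,\psi}(\delta,\epsilon)\supset^*\mathrm{ref}(\chi)\to\mathrm{univ}_{\varphi\supset\chi,\psi\supset\chi}(\lambda p{:}\varphi\supset\chi.\lambda q{:}\psi.p(\epsilon q),\ \lambda p{:}\psi\supset\chi.\lambda q{:}\varphi.p(\delta q))$; $\mathrm{univ}_{\varphi,\psi}(\delta,\epsilon)\supset^*\mathrm{univ}_{\varphi',\psi'}(\delta',\epsilon')\to\mathrm{univ}_{\varphi\supset\varphi',\psi\supset\psi'}(\lambda p{:}\varphi\supset\varphi'.\lambda q{:}\psi.\delta'(p(\epsilon q)),\ \lambda p{:}\psi\supset\psi'.\lambda q{:}\varphi.\epsilon'(p(\delta q)))$; $P_{MN}Q\to P'_{MN}Q$ if $P\to P'$; $\mathrm{ref}(M)_{NN'}P\to\mathrm{ref}(M')_{NN'}P$ if $M\to M'$; $P\supset^*Q\to P'\supset^*Q$ if $P\to P'$; $P\supset^*Q\to P\supset^*Q'$ if $Q\to Q'$. $\twoheadrightarrow$ ("reduces to") is the reflexive transitive closure of $\to$; $\simeq$ is its reflexive symmetric transitive closure. **Rules of deduction** (premises $\Rightarrow$ conclusion). Contexts: $\langle\rangle\vdash\mathrm{valid}$;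 $\Gamma\vdash\mathrm{valid}\Rightarrow\Gamma,x:A\vdash\mathrm{valid}$; $\Gamma\vdash\varphi:\Omega\Rightarrow\Gamma,p:\varphi\vdash\mathrm{valid}$; $\Gamma\vdash M:A,\ \Gamma\vdash N:A\Rightarrow\Gamma,e:M=_AN\vdash\mathrm{valid}$; if $\Gamma\vdash\mathrm{valid}$ then $\Gamma\vdash x:A$, $\Gamma\vdash p:\varphi$, $\Gamma\vdash e:M=_AN$ for the respective entries in $\Gamma$. Terms: $\Gamma\vdash\mathrm{valid}\Rightarrow\Gamma\vdash\bot:\Omega$; $\Gamma\vdash\varphi:\Omega,\ \Gamma\vdash\psi:\Omega\Rightarrow\Gamma\vdash\varphi\supset\psi:\Omega$; $\Gamma\vdash M:A\to B,\ \Gamma\vdash N:A\Rightarrow\Gamma\vdash MN:B$; $\Gamma,x:A\vdash M:B\Rightarrow\Gamma\vdash\lambda x{:}A.M:A\to B$. Proofs: $\Gamma\vdash\delta:\varphi\supset\psi,\ \Gamma\vdash\epsilon:\varphi\Rightarrow\Gamma\vdash\delta\epsilon:\psi$; $\Gamma,p:\varphi\vdash\delta:\psi\Rightarrow\Gamma\vdash\lambda p{:}\varphi.\delta:\varphi\supset\psi$; $\Gamma\vdash\delta:\varphi,\ \Gamma\vdash\psi:\Omega,\ \varphi\simeq\psi\Rightarrow\Gamma\vdash\delta:\psi$. Paths: $\Gamma\vdash M:A\Rightarrow\Gamma\vdash\mathrm{ref}(M):M=_AM$; $\Gamma\vdash P:\varphi=_\Omega\varphi',\ \Gamma\vdash Q:\psi=_\Omega\psi'\Rightarrow\Gamma\vdash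 P\supset^*Q:\varphi\supset\psi=_\Omega\varphi'\supset\psi'$; $\Gamma\vdash\delta:\varphi\supset\psi,\ \Gamma\vdash\epsilon:\psi\supset\varphi\Rightarrow\Gamma\vdash\mathrm{univ}_{\varphi,\psi}(\delta,\epsilon):\varphi=_\Omega\psi$; $\Gamma\vdash P:\varphi=_\Omega\psi\Rightarrow\Gamma\vdash P^+:\varphi\supset\psi$; $\Gamma\vdash P:\varphi=_\Omega\psi\Rightarrow\Gamma\vdash P^-:\psi\supset\varphi$; $\Gamma,x:A,y:A,e:x=_Ay\vdash P:Mx=_BNy,\ \Gamma\vdash M:A\to B,\ \Gamma\vdash N:A\to B\Rightarrow\Gamma\vdash\lambda\!\!\lambda\!\!\lambda e{:}x=_Ay.P:M=_{A\to B}N$; $\Gamma\vdash P:M=_{A\to B}M',\ \Gamma\vdash Q:N=_AN',\ \Gamma\vdash N:A,\ \Gamma\vdash N':A\Rightarrow\Gamma\vdash P_{NN'}Q:MN=_BM'N'$; $\Gamma\vdash P:M=_AN,\ \Gamma\vdash M':A,\ \Gamma\vdash N':A,\ M\simeq M',\ N\simeq N'\Rightarrow\Gamma\vdash P:M'=_AN'$. **Neutral** proofs and paths: $\delta_n::=p\mid P_n^+\mid P_n^-\mid\delta_n\epsilon$; $P_n::=e\mid P_n\supset^*Q\mid Q\supset^*P_n\mid(P_n)_{MN}Q$ (with $\epsilon$, $Q$, $M$, $N$ arbitrary). -}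

module Defs where

open import Data.List.Base using (List; []; _∷_)
open import Data.List.Membership.Propositional using (_∈_)
open import Data.List.Relation.Unary.Any using (here; there)
open import Function.Base using (_∘_)
open import Relation.Binary.Construct.Closure.ReflexiveTransitive using (Star)
open import Relation.Binary.Construct.Closure.Equivalence using (EqClosure)
open import Relation.Binary.PropositionalEquality using (refl)

-- Expressions up to α-conversion are represented by well-scoped de Bruijn
-- terms.  A scope lists the kinds of the variables in scope, the most recently
-- declared one first, and a variable of kind k is a position of k in the scope.

data Kind : Set where
  term proof path : Kind

Scope : Set
Scope = List Kind

private
  variable
    U V W : Scope
    k l   : Kind

pattern v₀ = here refl
pattern v₁ = there v₀
pattern v₂ = there v₁

infixr 25 _⇒_

data Ty : Set where
  Ω   : Ty
  _⇒_ : Ty → Ty → Ty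

infixr 25 _⊃_ _⊃*_
infixl 30 _·_ _∙_ _·⟨_,_⟩_
infix  35 _⁺ _⁻

data Expr (V : Scope) : Kind → Set where
  var        : k ∈ V → Expr V k
  bot        : Expr V term
  _⊃_        : Expr V term → Expr V term → Expr V term
  ƛ          : Ty → Expr (term ∷ V) term → Expr V term
  _·_        : Expr V term → Expr V term → Expr V term
  ƛₚ         : Expr V term → Expr (proof ∷ V) proof → Expr V proof
  _∙_        : Expr V proof → Expr V proof → Expr V proof
  _⁺ _⁻      : Expr V path → Expr V proof
  ref        : Expr V term → Expr V path
  _⊃*_       : Expr V path → Expr V path → Expr V path
  univ       : (φ ψ : Expr V term) (δ ε : Expr V proof) → Expr V path
  -- ƛ* A P is λλλ e : x =_A y . P, with x, y, e being v₂, v₁, v₀ in P.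
  ƛ*         : Ty → Expr (path ∷ term ∷ term ∷ V) path → Expr V path
  -- P ·⟨ M , N ⟩ Q is P_{MN} Q.
  _·⟨_,_⟩_   : (P : Expr V path) (M N : Expr V term) (Q : Expr V path) →
               Expr V path

Term Proof Path : Scope → Set
Term  V = Expr V term
Proof V = Expr V proof
Path  V = Expr V path

Ren : Scope → Scope → Set
Ren V W = ∀ {k} → k ∈ V → k ∈ W

liftRen : Ren V W → Ren (l ∷ V) (l ∷ W)
liftRen ρ (here eq) = here eq
liftRen ρ (there x) = there (ρ x)

rename : Ren V W → Expr V k → Expr W k
rename ρ (var x)            = var (ρ x)
rename ρ bot                = bot
rename ρ (φ ⊃ ψ)            = rename ρ φ ⊃ rename ρ ψ
rename ρ (ƛ A M)            = ƛ A (rename (liftRen ρ) M)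
rename ρ (M · N)            = rename ρ M · rename ρ N
rename ρ (ƛₚ φ δ)           = ƛₚ (rename ρ φ) (rename (liftRen ρ) δ)
rename ρ (δ ∙ ε)            = rename ρ δ ∙ rename ρ ε
rename ρ (P ⁺)              = rename ρ P ⁺
rename ρ (P ⁻)              = rename ρ P ⁻
rename ρ (ref M)            = ref (rename ρ M)
rename ρ (P ⊃* Q)           = rename ρ P ⊃* rename ρ Q
rename ρ (univ φ ψ δ ε)     = univ (rename ρ φ) (rename ρ ψ) (rename ρ δ) (rename ρ ε)
rename ρ (ƛ* A P)           = ƛ* A (rename (liftRen (liftRen (liftRen ρ))) P)
rename ρ (P ·⟨ M , N ⟩ Q)   = rename ρ P ·⟨ rename ρ M , rename ρ N ⟩ rename ρ Q

wk : Expr V k → Expr (l ∷ V) k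
wk = rename there

wk³ : Expr V k → Expr (path ∷ term ∷ term ∷ V) k
wk³ = rename (there ∘ there ∘ there)

Sub : Scope → Scope → Set
Sub V W = ∀ {k} → k ∈ V → Expr W k

infixl 20 _◂_

_◂_ : Sub V W → Expr W l → Sub (l ∷ V) W
(σ ◂ E) (here refl) = E
(σ ◂ E) (there x)   = σ x

liftSub : Sub V W → Sub (l ∷ V) (l ∷ W)
liftSub σ = (wk ∘ σ) ◂ var v₀

sub : Sub V W → Expr V k → Expr W k
sub σ (var x)            = σ x
sub σ bot                = bot
sub σ (φ ⊃ ψ)            = sub σ φ ⊃ sub σ ψ
sub σ (ƛ A M)            = ƛ A (sub (liftSub σ) M)
sub σ (M · N)            = sub σ M · sub σ N
sub σ (ƛₚ φ δ)           = ƛₚ (sub σ φ) (sub (liftSub σ) δ)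
sub σ (δ ∙ ε)            = sub σ δ ∙ sub σ ε
sub σ (P ⁺)              = sub σ P ⁺
sub σ (P ⁻)              = sub σ P ⁻
sub σ (ref M)            = ref (sub σ M)
sub σ (P ⊃* Q)           = sub σ P ⊃* sub σ Q
sub σ (univ φ ψ δ ε)     = univ (sub σ φ) (sub σ ψ) (sub σ δ) (sub σ ε)
sub σ (ƛ* A P)           = ƛ* A (sub (liftSub (liftSub (liftSub σ))) P)
sub σ (P ·⟨ M , N ⟩ Q)   = sub σ P ·⟨ sub σ M , sub σ N ⟩ sub σ Q

infix 40 _[_]

_[_] : Expr (l ∷ V) k → Expr V l → Expr V k
E [ F ] = sub (var ◂ F) E

-- The path L{x⃗ := P⃗ : M⃗ = N⃗} is written L ⟦ τ ∶ ρ ∼ σ ⟧, where τ, ρ and σ give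
-- the P, M and N of every term variable of the scope of L at once.  A variable y
-- that is not among the x⃗ has τ y = ref (var y) and ρ y = σ y = var y.

PathSub : Scope → Scope → Set
PathSub V W = term ∈ V → Path W

infixl 20 _◂ᵖ_

_◂ᵖ_ : PathSub V W → Path W → PathSub (term ∷ V) W
(τ ◂ᵖ P) (here refl) = P
(τ ◂ᵖ P) (there x)   = τ x

infix 40 _⟦_∶_∼_⟧

_⟦_∶_∼_⟧ : Term V → PathSub V W → Sub V W → Sub V W → Path W
var x   ⟦ τ ∶ ρ ∼ σ ⟧ = τ x
bot     ⟦ τ ∶ ρ ∼ σ ⟧ = ref bot
(φ ⊃ ψ) ⟦ τ ∶ ρ ∼ σ ⟧ = φ ⟦ τ ∶ ρ ∼ σ ⟧ ⊃* ψ ⟦ τ ∶ ρ ∼ σ ⟧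
(L · K) ⟦ τ ∶ ρ ∼ σ ⟧ =
  L ⟦ τ ∶ ρ ∼ σ ⟧ ·⟨ sub ρ K , sub σ K ⟩ K ⟦ τ ∶ ρ ∼ σ ⟧
ƛ A L   ⟦ τ ∶ ρ ∼ σ ⟧ =
  ƛ* A (L ⟦ (wk³ ∘ τ) ◂ᵖ var v₀ ∶ (wk³ ∘ ρ) ◂ var v₂ ∼ (wk³ ∘ σ) ◂ var v₁ ⟧)

infix 40 _⟦_∶_≈_⟧

-- L{x := P : M = N} for a single variable x, namely v₀.
_⟦_∶_≈_⟧ : Term (term ∷ V) → Path V → Term V → Term V → Path V
L ⟦ P ∶ M ≈ N ⟧ = L ⟦ (ref ∘ var) ◂ᵖ P ∶ var ◂ M ∼ var ◂ N ⟧

infix 10 _⟶_ _↠_ _≃_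

data _⟶_ {V : Scope} : Expr V k → Expr V k → Set where

  β : ∀ {A M N} → ƛ A M · N ⟶ M [ N ]

  ·ˡ : ∀ {M M′ N : Term V} → M ⟶ M′ → M · N ⟶ M′ · N

  ⊃ˡ : ∀ {φ φ′ ψ : Term V} → φ ⟶ φ′ → φ ⊃ ψ ⟶ φ′ ⊃ ψ

  ⊃ʳ : ∀ {φ ψ ψ′ : Term V} → ψ ⟶ ψ′ → φ ⊃ ψ ⟶ φ ⊃ ψ′

  βₚ : ∀ {φ δ ε} → ƛₚ φ δ ∙ ε ⟶ δ [ ε ]

  ref⁺ : ∀ {φ} → ref φ ⁺ ⟶ ƛₚ φ (var v₀)

  ref⁻ : ∀ {φ} → ref φ ⁻ ⟶ ƛₚ φ (var v₀)

  univ⁺ : ∀ {φ ψ δ ε} → univ φ ψ δ ε ⁺ ⟶ δ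

  univ⁻ : ∀ {φ ψ δ ε} → univ φ ψ δ ε ⁻ ⟶ ε

  ∙ˡ : ∀ {δ δ′ ε : Proof V} → δ ⟶ δ′ → δ ∙ ε ⟶ δ′ ∙ ε

  ⁺-cong : ∀ {P Q : Path V} → P ⟶ Q → P ⁺ ⟶ Q ⁺

  ⁻-cong : ∀ {P Q : Path V} → P ⟶ Q → P ⁻ ⟶ Q ⁻

  β* : ∀ {A P M N Q} →
    ƛ* A P ·⟨ M , N ⟩ Q ⟶ sub (var ◂ M ◂ N ◂ Q) P

  refƛ : ∀ {A M N N′ P} →
    ref (ƛ A M) ·⟨ N , N′ ⟩ P ⟶ M ⟦ P ∶ N ≈ N′ ⟧

  ref⊃*ref : ∀ {φ ψ} → ref φ ⊃* ref ψ ⟶ ref (φ ⊃ ψ)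

  ref⊃*univ : ∀ {φ ψ χ δ ε} →
    ref φ ⊃* univ ψ χ δ ε ⟶
    univ (φ ⊃ ψ) (φ ⊃ χ)
      (ƛₚ (φ ⊃ ψ) (ƛₚ (wk φ) (wk (wk δ) ∙ (var v₁ ∙ var v₀))))
      (ƛₚ (φ ⊃ χ) (ƛₚ (wk φ) (wk (wk ε) ∙ (var v₁ ∙ var v₀))))

  univ⊃*ref : ∀ {φ ψ χ δ ε} →
    univ φ ψ δ ε ⊃* ref χ ⟶
    univ (φ ⊃ χ) (ψ ⊃ χ)
      (ƛₚ (φ ⊃ χ) (ƛₚ (wk ψ) (var v₁ ∙ (wk (wk ε) ∙ var v₀))))
      (ƛₚ (ψ ⊃ χ) (ƛₚ (wk φ) (var v₁ ∙ (wk (wk δ) ∙ var v₀))))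

  univ⊃*univ : ∀ {φ ψ δ ε φ′ ψ′ δ′ ε′} →
    univ φ ψ δ ε ⊃* univ φ′ ψ′ δ′ ε′ ⟶
    univ (φ ⊃ φ′) (ψ ⊃ ψ′)
      (ƛₚ (φ ⊃ φ′) (ƛₚ (wk ψ) (wk (wk δ′) ∙ (var v₁ ∙ (wk (wk ε) ∙ var v₀)))))
      (ƛₚ (ψ ⊃ ψ′) (ƛₚ (wk φ) (wk (wk ε′) ∙ (var v₁ ∙ (wk (wk δ) ∙ var v₀)))))

  ·*ˡ : ∀ {P P′ M N Q} → P ⟶ P′ → P ·⟨ M , N ⟩ Q ⟶ P′ ·⟨ M , N ⟩ Q

  ref·* : ∀ {M M′ N N′ P} → M ⟶ M′ →
    ref M ·⟨ N , N′ ⟩ P ⟶ ref M′ ·⟨ N , N′ ⟩ P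

  ⊃*ˡ : ∀ {P P′ Q : Path V} → P ⟶ P′ → P ⊃* Q ⟶ P′ ⊃* Q

  ⊃*ʳ : ∀ {P Q Q′ : Path V} → Q ⟶ Q′ → P ⊃* Q ⟶ P ⊃* Q′

_↠_ : Expr V k → Expr V k → Set
_↠_ = Star _⟶_

_≃_ : Expr V k → Expr V k → Set
_≃_ = EqClosure _⟶_

-- The right-hand sides of the judgements M : A, δ : φ and P : M =_A N.

infix 15 _=[_]_

data Class (V : Scope) : Kind → Set where
  ty     : Ty → Class V term
  pf     : Term V → Class V proof
  _=[_]_ : Term V → Ty → Term V → Class V path

wkClass : Class V k → Class (l ∷ V) k
wkClass (ty A)       = ty A
wkClass (pf φ)       = pf (wk φ)
wkClass (M =[ A ] N) = wk M =[ A ] wk N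

infixl 10 _▹_

data Ctx : Scope → Set where
  ⟨⟩  : Ctx []
  _▹_ : Ctx V → Class V k → Ctx (k ∷ V)

lookup : Ctx V → k ∈ V → Class V k
lookup (Γ ▹ T) (here refl) = wkClass T
lookup (Γ ▹ T) (there x)   = wkClass (lookup Γ x)

-- Γ, x : A, y : A, e : x =_A y
_▹³_ : Ctx V → Ty → Ctx (path ∷ term ∷ term ∷ V)
Γ ▹³ A = Γ ▹ ty A ▹ ty A ▹ (var v₁ =[ A ] var v₀)

infix 5 _⊢valid _⊢_∶_

data _⊢valid : Ctx V → Set
data _⊢_∶_ {V : Scope} (Γ : Ctx V) : Expr V k → Class V k → Set

data _⊢valid where

  ⟨⟩ : ⟨⟩ ⊢valid

  ▹-ty : ∀ {Γ : Ctx V} {A} → Γ ⊢valid → Γ ▹ ty A ⊢valid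

  ▹-pf : ∀ {Γ : Ctx V} {φ} → Γ ⊢ φ ∶ ty Ω → Γ ▹ pf φ ⊢valid

  ▹-eq : ∀ {Γ : Ctx V} {M N A} → Γ ⊢ M ∶ ty A → Γ ⊢ N ∶ ty A →
    Γ ▹ (M =[ A ] N) ⊢valid

data _⊢_∶_ {V} Γ where

  ⊢var : Γ ⊢valid → (x : k ∈ V) → Γ ⊢ var x ∶ lookup Γ x

  ⊢bot : Γ ⊢valid → Γ ⊢ bot ∶ ty Ω

  ⊢⊃ : ∀ {φ ψ} → Γ ⊢ φ ∶ ty Ω → Γ ⊢ ψ ∶ ty Ω → Γ ⊢ φ ⊃ ψ ∶ ty Ω

  ⊢· : ∀ {A B M N} → Γ ⊢ M ∶ ty (A ⇒ B) → Γ ⊢ N ∶ ty A → Γ ⊢ M · N ∶ ty B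

  ⊢ƛ : ∀ {A B M} → Γ ▹ ty A ⊢ M ∶ ty B → Γ ⊢ ƛ A M ∶ ty (A ⇒ B)

  ⊢∙ : ∀ {φ ψ δ ε} → Γ ⊢ δ ∶ pf (φ ⊃ ψ) → Γ ⊢ ε ∶ pf φ → Γ ⊢ δ ∙ ε ∶ pf ψ

  ⊢ƛₚ : ∀ {φ ψ δ} → Γ ▹ pf φ ⊢ δ ∶ pf (wk ψ) → Γ ⊢ ƛₚ φ δ ∶ pf (φ ⊃ ψ)

  ⊢convₚ : ∀ {φ ψ δ} → Γ ⊢ δ ∶ pf φ → Γ ⊢ ψ ∶ ty Ω → φ ≃ ψ → Γ ⊢ δ ∶ pf ψ

  ⊢ref : ∀ {A M} → Γ ⊢ M ∶ ty A → Γ ⊢ ref M ∶ (M =[ A ] M)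

  ⊢⊃* : ∀ {φ φ′ ψ ψ′ P Q} → Γ ⊢ P ∶ (φ =[ Ω ] φ′) → Γ ⊢ Q ∶ (ψ =[ Ω ] ψ′) →
    Γ ⊢ P ⊃* Q ∶ (φ ⊃ ψ =[ Ω ] φ′ ⊃ ψ′)

  ⊢univ : ∀ {φ ψ δ ε} → Γ ⊢ δ ∶ pf (φ ⊃ ψ) → Γ ⊢ ε ∶ pf (ψ ⊃ φ) →
    Γ ⊢ univ φ ψ δ ε ∶ (φ =[ Ω ] ψ)

  ⊢⁺ : ∀ {φ ψ P} → Γ ⊢ P ∶ (φ =[ Ω ] ψ) → Γ ⊢ P ⁺ ∶ pf (φ ⊃ ψ)

  ⊢⁻ : ∀ {φ ψ P} → Γ ⊢ P ∶ (φ =[ Ω ] ψ) → Γ ⊢ P ⁻ ∶ pf (ψ ⊃ φ)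

  ⊢ƛ* : ∀ {A B M N P} →
    Γ ▹³ A ⊢ P ∶ (wk³ M · var v₂ =[ B ] wk³ N · var v₁) →
    Γ ⊢ M ∶ ty (A ⇒ B) → Γ ⊢ N ∶ ty (A ⇒ B) →
    Γ ⊢ ƛ* A P ∶ (M =[ A ⇒ B ] N)

  ⊢·* : ∀ {A B M M′ N N′ P Q} →
    Γ ⊢ P ∶ (M =[ A ⇒ B ] M′) → Γ ⊢ Q ∶ (N =[ A ] N′) →
    Γ ⊢ N ∶ ty A → Γ ⊢ N′ ∶ ty A →
    Γ ⊢ P ·⟨ N , N′ ⟩ Q ∶ (M · N =[ B ] M′ · N′)

  ⊢conv* : ∀ {A M M′ N N′ P} → Γ ⊢ P ∶ (M =[ A ] N) →
    Γ ⊢ M′ ∶ ty A → Γ ⊢ N′ ∶ ty A → M ≃ M′ → N ≃ N′ →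
    Γ ⊢ P ∶ (M′ =[ A ] N′)

data NeutralPath {V : Scope} : Path V → Set where
  var  : (e : path ∈ V) → NeutralPath (var e)
  ⊃*ˡ  : ∀ {P Q} → NeutralPath P → NeutralPath (P ⊃* Q)
  ⊃*ʳ  : ∀ {P Q} → NeutralPath P → NeutralPath (Q ⊃* P)
  app* : ∀ {P M N Q} → NeutralPath P → NeutralPath (P ·⟨ M , N ⟩ Q)

data NeutralProof {V : Scope} : Proof V → Set where
  var : (p : proof ∈ V) → NeutralProof (var p)
  _⁺  : ∀ {P} → NeutralPath P → NeutralProof (P ⁺)
  _⁻  : ∀ {P} → NeutralPath P → NeutralProof (P ⁻)
  app : ∀ {δ ε} → NeutralProof δ → NeutralProof (δ ∙ ε)

{-# OPTIONS --safe #-}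
module Submission where

-- Head normalisation comes from a Kripke logical relation that ignores typing: a
-- path at Ω is computable when it reduces to a neutral path, to ref or to univ with
-- computable components, and at A ⇒ B when it reduces to a value and sends
-- computable arguments to computable results. Without term variables the identity
-- substitution is computable and every proposition has a normal form built from ⊥
-- and ⊃, so that proofs can be interpreted by recursion on these normal forms.
-- The typing of the values is recovered from subject reduction, inversion of typing
-- and the confluence of term reduction, which has the diamond property because
-- call-by-name β-redexes do not overlap.

open import Defs
open import Data.Empty using (⊥-elim)
open import Data.List.Base using (_∷_)
open import Data.List.Membership.Propositional using (_∈_; _∉_)
open import Data.List.Relation.Unary.Any using (here; there)
open import Data.Product.Base using (_×_; _,_; proj₁; proj₂; ∃-syntax)
open import Data.Sum.Base using (_⊎_; inj₁; inj₂)
open import Data.Unit.Base using (⊤)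
open import Function.Base using (_∘_)
open import Relation.Binary.Construct.Closure.Equivalence as Eq using (symmetric)
open import Relation.Binary.Construct.Closure.Equivalence.Properties
  using (a—↠b⇒a↔b; a—↠b⇒b↔a)
open import Relation.Binary.Construct.Closure.ReflexiveTransitive
  using (_◅_; _◅◅_; gmap) renaming (ε to nil)
open import Relation.Binary.Construct.Closure.Symmetric using (fwd; bwd)
open import Relation.Binary.PropositionalEquality
  using (_≡_; refl; sym; trans; cong; cong₂; subst; subst₂; module ≡-Reasoning)
open import Relation.Binary.Rewriting using (Confluent; IsNormalForm; conf⇒nf; conf⇒unf)

-- The absence of term variables is what makes the listed shapes exhaustive. For a variable x of
-- type A ⇒ B the path `ref (var x) ·⟨ N , N′ ⟩ Q` is stuck, yet neither neutral nor a value, and a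
-- variable of type Ω has no normal form built from ⊥ and ⊃. Proof and path variables do no harm,
-- since they are neutral. A proposition may be an application, and the conversion rules may
-- exchange it for another one, so its own structure offers no recursion for interpreting proofs.
-- Its normal form does, and convertible propositions then share one interpretation. The logical
-- relation only delivers the shape that is reached. Annotations inside the reduct agree with the
-- declared propositions and endpoints merely up to ≃, so inversion has to see through any number of
-- conversions. Confluence serves both this and the uniqueness of normal forms; proving it for terms
-- suffices because propositions and endpoints are terms, and terms contain neither proofs nor
-- paths.

private
  variable
    U V W : Scope
    k l   : Kind

-- Calculus of renaming and substitution

cong₄ : ∀ {A B C D E : Set} (f : A → B → C → D → E) {a a′ b b′ c c′ d d′} →
  a ≡ a′ → b ≡ b′ → c ≡ c′ → d ≡ d′ → f a b c d ≡ f a′ b′ c′ d′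
cong₄ f refl refl refl refl = refl

infix 4 _≗_

_≗_ : Sub V W → Sub V W → Set
_≗_ {V} σ σ′ = ∀ {k} (x : k ∈ V) → σ x ≡ σ′ x

lift-cong : {σ σ′ : Sub V W} → σ ≗ σ′ → liftSub {l = l} σ ≗ liftSub σ′
lift-cong eq (here refl) = refl
lift-cong eq (there x)   = cong wk (eq x)

sub-cong : {σ σ′ : Sub V W} → σ ≗ σ′ → (E : Expr V k) → sub σ E ≡ sub σ′ E
sub-cong eq (var x)          = eq x
sub-cong eq bot              = refl
sub-cong eq (φ ⊃ ψ)          = cong₂ _⊃_ (sub-cong eq φ) (sub-cong eq ψ)
sub-cong eq (ƛ A M)          = cong (ƛ A) (sub-cong (lift-cong eq) M)
sub-cong eq (M · N)          = cong₂ _·_ (sub-cong eq M) (sub-cong eq N)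
sub-cong eq (ƛₚ φ δ)         = cong₂ ƛₚ (sub-cong eq φ) (sub-cong (lift-cong eq) δ)
sub-cong eq (δ ∙ ε)          = cong₂ _∙_ (sub-cong eq δ) (sub-cong eq ε)
sub-cong eq (P ⁺)            = cong _⁺ (sub-cong eq P)
sub-cong eq (P ⁻)            = cong _⁻ (sub-cong eq P)
sub-cong eq (ref M)          = cong ref (sub-cong eq M)
sub-cong eq (P ⊃* Q)         = cong₂ _⊃*_ (sub-cong eq P) (sub-cong eq Q)
sub-cong eq (univ φ ψ δ ε)   =
  cong₄ univ (sub-cong eq φ) (sub-cong eq ψ) (sub-cong eq δ) (sub-cong eq ε)
sub-cong eq (ƛ* A P)         =
  cong (ƛ* A) (sub-cong (lift-cong (lift-cong (lift-cong eq))) P)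
sub-cong eq (P ·⟨ M , N ⟩ Q) =
  cong₄ _·⟨_,_⟩_ (sub-cong eq P) (sub-cong eq M) (sub-cong eq N) (sub-cong eq Q)

lift-var : {σ : Sub V V} → σ ≗ var → liftSub {l = l} σ ≗ var
lift-var eq (here refl) = refl
lift-var eq (there x)   = cong wk (eq x)

sub-var : {σ : Sub V V} → σ ≗ var → (E : Expr V k) → sub σ E ≡ E
sub-var eq (var x)          = eq x
sub-var eq bot              = refl
sub-var eq (φ ⊃ ψ)          = cong₂ _⊃_ (sub-var eq φ) (sub-var eq ψ)
sub-var eq (ƛ A M)          = cong (ƛ A) (sub-var (lift-var eq) M)
sub-var eq (M · N)          = cong₂ _·_ (sub-var eq M) (sub-var eq N)
sub-var eq (ƛₚ φ δ)         = cong₂ ƛₚ (sub-var eq φ) (sub-var (lift-var eq) δ)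
sub-var eq (δ ∙ ε)          = cong₂ _∙_ (sub-var eq δ) (sub-var eq ε)
sub-var eq (P ⁺)            = cong _⁺ (sub-var eq P)
sub-var eq (P ⁻)            = cong _⁻ (sub-var eq P)
sub-var eq (ref M)          = cong ref (sub-var eq M)
sub-var eq (P ⊃* Q)         = cong₂ _⊃*_ (sub-var eq P) (sub-var eq Q)
sub-var eq (univ φ ψ δ ε)   =
  cong₄ univ (sub-var eq φ) (sub-var eq ψ) (sub-var eq δ) (sub-var eq ε)
sub-var eq (ƛ* A P)         =
  cong (ƛ* A) (sub-var (lift-var (lift-var (lift-var eq))) P)
sub-var eq (P ·⟨ M , N ⟩ Q) =
  cong₄ _·⟨_,_⟩_ (sub-var eq P) (sub-var eq M) (sub-var eq N) (sub-var eq Q)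

lift-ren : {ρ : Ren V W} {σ : Sub V W} → var ∘ ρ ≗ σ →
  var ∘ liftRen {l = l} ρ ≗ liftSub σ
lift-ren eq (here refl) = refl
lift-ren eq (there x)   = cong wk (eq x)

rename≡sub′ : {ρ : Ren V W} {σ : Sub V W} → var ∘ ρ ≗ σ →
  (E : Expr V k) → rename ρ E ≡ sub σ E
rename≡sub′ eq (var x)          = eq x
rename≡sub′ eq bot              = refl
rename≡sub′ eq (φ ⊃ ψ)          = cong₂ _⊃_ (rename≡sub′ eq φ) (rename≡sub′ eq ψ)
rename≡sub′ eq (ƛ A M)          = cong (ƛ A) (rename≡sub′ (lift-ren eq) M)
rename≡sub′ eq (M · N)          = cong₂ _·_ (rename≡sub′ eq M) (rename≡sub′ eq N)
rename≡sub′ eq (ƛₚ φ δ)         = cong₂ ƛₚ (rename≡sub′ eq φ) (rename≡sub′ (lift-ren eq) δ)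
rename≡sub′ eq (δ ∙ ε)          = cong₂ _∙_ (rename≡sub′ eq δ) (rename≡sub′ eq ε)
rename≡sub′ eq (P ⁺)            = cong _⁺ (rename≡sub′ eq P)
rename≡sub′ eq (P ⁻)            = cong _⁻ (rename≡sub′ eq P)
rename≡sub′ eq (ref M)          = cong ref (rename≡sub′ eq M)
rename≡sub′ eq (P ⊃* Q)         = cong₂ _⊃*_ (rename≡sub′ eq P) (rename≡sub′ eq Q)
rename≡sub′ eq (univ φ ψ δ ε)   =
  cong₄ univ (rename≡sub′ eq φ) (rename≡sub′ eq ψ) (rename≡sub′ eq δ) (rename≡sub′ eq ε)
rename≡sub′ eq (ƛ* A P)         =
  cong (ƛ* A) (rename≡sub′ (lift-ren (lift-ren (lift-ren eq))) P)
rename≡sub′ eq (P ·⟨ M , N ⟩ Q) =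
  cong₄ _·⟨_,_⟩_ (rename≡sub′ eq P) (rename≡sub′ eq M) (rename≡sub′ eq N) (rename≡sub′ eq Q)

rename≡sub : (ρ : Ren V W) (E : Expr V k) → rename ρ E ≡ sub (var ∘ ρ) E
rename≡sub ρ = rename≡sub′ λ _ → refl

-- R says that σ₃ is the composite of σ₁ and σ₂. It is instantiated with σ₁ a renaming,
-- then with σ₂ a renaming, which is what closure under lifting needs in general.
module Fusion
  (R : ∀ {U V W} → Sub U V → Sub V W → Sub U W → Set)
  (lift : ∀ {U V W l} {σ₁ : Sub U V} {σ₂ : Sub V W} {σ₃ : Sub U W} →
    R σ₁ σ₂ σ₃ → R (liftSub {l = l} σ₁) (liftSub σ₂) (liftSub σ₃))
  (at : ∀ {U V W k} {σ₁ : Sub U V} {σ₂ : Sub V W} {σ₃ : Sub U W} →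
    R σ₁ σ₂ σ₃ → (x : k ∈ U) → sub σ₂ (σ₁ x) ≡ σ₃ x) where

  fuse : {σ₁ : Sub U V} {σ₂ : Sub V W} {σ₃ : Sub U W} → R σ₁ σ₂ σ₃ →
    (E : Expr U k) → sub σ₂ (sub σ₁ E) ≡ sub σ₃ E
  fuse r (var x)          = at r x
  fuse r bot              = refl
  fuse r (φ ⊃ ψ)          = cong₂ _⊃_ (fuse r φ) (fuse r ψ)
  fuse r (ƛ A M)          = cong (ƛ A) (fuse (lift r) M)
  fuse r (M · N)          = cong₂ _·_ (fuse r M) (fuse r N)
  fuse r (ƛₚ φ δ)         = cong₂ ƛₚ (fuse r φ) (fuse (lift r) δ)
  fuse r (δ ∙ ε)          = cong₂ _∙_ (fuse r δ) (fuse r ε)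
  fuse r (P ⁺)            = cong _⁺ (fuse r P)
  fuse r (P ⁻)            = cong _⁻ (fuse r P)
  fuse r (ref M)          = cong ref (fuse r M)
  fuse r (P ⊃* Q)         = cong₂ _⊃*_ (fuse r P) (fuse r Q)
  fuse r (univ φ ψ δ ε)   = cong₄ univ (fuse r φ) (fuse r ψ) (fuse r δ) (fuse r ε)
  fuse r (ƛ* A P)         = cong (ƛ* A) (fuse (lift (lift (lift r))) P)
  fuse r (P ·⟨ M , N ⟩ Q) = cong₄ _·⟨_,_⟩_ (fuse r P) (fuse r M) (fuse r N) (fuse r Q)

module _ where
  private
    data R {U V W} (σ₁ : Sub U V) (σ₂ : Sub V W) (σ₃ : Sub U W) : Set where
      triple : (ρ : Ren U V) → var ∘ ρ ≗ σ₁ → σ₂ ∘ ρ ≗ σ₃ → R σ₁ σ₂ σ₃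

    lift : ∀ {U V W l} {σ₁ : Sub U V} {σ₂ : Sub V W} {σ₃ : Sub U W} →
      R σ₁ σ₂ σ₃ → R (liftSub {l = l} σ₁) (liftSub σ₂) (liftSub σ₃)
    lift (triple ρ eq eq′) = triple (liftRen ρ) (lift-ren eq)
      λ { (here refl) → refl ; (there x) → cong wk (eq′ x) }

    at : ∀ {U V W k} {σ₁ : Sub U V} {σ₂ : Sub V W} {σ₃ : Sub U W} →
      R σ₁ σ₂ σ₃ → (x : k ∈ U) → sub σ₂ (σ₁ x) ≡ σ₃ x
    at {σ₂ = σ₂} (triple ρ eq eq′) x = trans (cong (sub σ₂) (sym (eq x))) (eq′ x)

  sub-rename : (σ : Sub V W) (ρ : Ren U V) (E : Expr U k) →
    sub σ (rename ρ E) ≡ sub (σ ∘ ρ) E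
  sub-rename σ ρ E = trans (cong (sub σ) (rename≡sub ρ E))
    (Fusion.fuse R lift at (triple ρ (λ _ → refl) λ _ → refl) E)

rename-rename : (ρ′ : Ren V W) (ρ : Ren U V) (E : Expr U k) →
  rename ρ′ (rename ρ E) ≡ rename (ρ′ ∘ ρ) E
rename-rename ρ′ ρ E = begin
  rename ρ′ (rename ρ E)       ≡⟨ rename≡sub ρ′ (rename ρ E) ⟩
  sub (var ∘ ρ′) (rename ρ E)  ≡⟨ sub-rename (var ∘ ρ′) ρ E ⟩
  sub (var ∘ ρ′ ∘ ρ) E         ≡⟨ rename≡sub (ρ′ ∘ ρ) E ⟨
  rename (ρ′ ∘ ρ) E            ∎
  where open ≡-Reasoning

wk-rename : (ρ : Ren V W) (E : Expr V k) →
  rename (liftRen {l = l} ρ) (wk E) ≡ wk (rename ρ E)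
wk-rename ρ E = trans (rename-rename (liftRen ρ) there E) (sym (rename-rename there ρ E))

module _ where
  private
    data R {U V W} (σ₁ : Sub U V) (σ₂ : Sub V W) (σ₃ : Sub U W) : Set where
      triple : (ρ : Ren V W) → var ∘ ρ ≗ σ₂ → rename ρ ∘ σ₁ ≗ σ₃ → R σ₁ σ₂ σ₃

    lift : ∀ {U V W l} {σ₁ : Sub U V} {σ₂ : Sub V W} {σ₃ : Sub U W} →
      R σ₁ σ₂ σ₃ → R (liftSub {l = l} σ₁) (liftSub σ₂) (liftSub σ₃)
    lift {σ₁ = σ₁} (triple ρ eq eq′) = triple (liftRen ρ) (lift-ren eq)
      λ { (here refl) → refl ; (there x) → trans (wk-rename ρ (σ₁ x)) (cong wk (eq′ x)) }

    at : ∀ {U V W k} {σ₁ : Sub U V} {σ₂ : Sub V W} {σ₃ : Sub U W} →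
      R σ₁ σ₂ σ₃ → (x : k ∈ U) → sub σ₂ (σ₁ x) ≡ σ₃ x
    at {σ₁ = σ₁} (triple ρ eq eq′) x = trans (sym (rename≡sub′ eq (σ₁ x))) (eq′ x)

  rename-sub : (ρ : Ren V W) (σ : Sub U V) (E : Expr U k) →
    rename ρ (sub σ E) ≡ sub (rename ρ ∘ σ) E
  rename-sub ρ σ E = trans (rename≡sub ρ (sub σ E))
    (Fusion.fuse R lift at (triple ρ (λ _ → refl) λ _ → refl) E)

wk-sub : (σ : Sub V W) (E : Expr V k) → sub (liftSub {l = l} σ) (wk E) ≡ wk (sub σ E)
wk-sub σ E = trans (sub-rename (liftSub σ) there E) (sym (rename-sub there σ E))

-- `wk³` is a single renaming, whereas lifting a substitution three times weakens in three steps.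
wk³≡ : (E : Expr V k) → wk (wk (wk E)) ≡ wk³ E
wk³≡ E = trans (cong wk (rename-rename there there E)) (rename-rename there (there ∘ there) E)

wk³-sub : (σ : Sub V W) (E : Expr V k) →
  sub (liftSub (liftSub (liftSub σ))) (wk³ E) ≡ wk³ (sub σ E)
wk³-sub σ E = begin
  sub σ³ (wk³ E)                        ≡⟨ sub-rename σ³ (there ∘ there ∘ there) E ⟩
  sub (wk ∘ wk ∘ wk ∘ σ) E              ≡⟨ sub-cong (λ x → wk³≡ (σ x)) E ⟩
  sub (wk³ ∘ σ) E                       ≡⟨ rename-sub (there ∘ there ∘ there) σ E ⟨
  wk³ (sub σ E)                         ∎
  where open ≡-Reasoning
        σ³ : Sub _ _
        σ³ = liftSub (liftSub (liftSub σ))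

module _ where
  private
    R : ∀ {U V W} → Sub U V → Sub V W → Sub U W → Set
    R σ₁ σ₂ σ₃ = sub σ₂ ∘ σ₁ ≗ σ₃

    lift : ∀ {U V W l} {σ₁ : Sub U V} {σ₂ : Sub V W} {σ₃ : Sub U W} →
      R σ₁ σ₂ σ₃ → R (liftSub {l = l} σ₁) (liftSub σ₂) (liftSub σ₃)
    lift eq (here refl) = refl
    lift {σ₁ = σ₁} {σ₂ = σ₂} eq (there x) = trans (wk-sub σ₂ (σ₁ x)) (cong wk (eq x))

  sub-sub : (σ′ : Sub V W) (σ : Sub U V) (E : Expr U k) →
    sub σ′ (sub σ E) ≡ sub (sub σ′ ∘ σ) E
  sub-sub σ′ σ E = Fusion.fuse (λ {U} {V} {W} → R {U} {V} {W})
    (λ {_} {_} {_} {_} {σ₁} {σ₂} {σ₃} → lift {σ₁ = σ₁} {σ₂} {σ₃}) (λ eq → eq)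
    {σ₁ = σ} {σ₂ = σ′} (λ _ → refl) E

sub-id : (E : Expr V k) → sub var E ≡ E
sub-id = sub-var λ _ → refl

rename-id : (E : Expr V k) → rename (λ x → x) E ≡ E
rename-id E = trans (rename≡sub (λ x → x) E) (sub-id E)

sub-◂-wk : (σ : Sub V W) (F : Expr W l) (E : Expr V k) → sub (σ ◂ F) (wk E) ≡ sub σ E
sub-◂-wk σ F = sub-rename (σ ◂ F) there

sub-lift-◂ : (σ′ : Sub V W) (F : Expr W l) (σ : Sub U V) (E : Expr (l ∷ U) k) →
  sub (σ′ ◂ F) (sub (liftSub σ) E) ≡ sub ((sub σ′ ∘ σ) ◂ F) E
sub-lift-◂ σ′ F σ E = trans (sub-sub (σ′ ◂ F) (liftSub σ) E)
  (sub-cong (λ { (here refl) → refl ; (there x) → sub-◂-wk σ′ F (σ x) }) E)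

sub-[] : (σ : Sub V W) (E : Expr (l ∷ V) k) (F : Expr V l) →
  sub σ (E [ F ]) ≡ sub (liftSub σ) E [ sub σ F ]
sub-[] σ E F = begin
  sub σ (E [ F ])               ≡⟨ sub-sub σ (var ◂ F) E ⟩
  sub (sub σ ∘ (var ◂ F)) E     ≡⟨ sub-cong (λ { (here refl) → refl
                                              ; (there x) → sym (sub-id (σ x)) }) E ⟩
  sub ((sub var ∘ σ) ◂ sub σ F) E  ≡⟨ sub-lift-◂ var (sub σ F) σ E ⟨
  sub (liftSub σ) E [ sub σ F ] ∎
  where open ≡-Reasoning

-- Path substitution and its commutation laws

infix 4 _≗ᵖ_

_≗ᵖ_ : PathSub V W → PathSub V W → Set
τ ≗ᵖ τ′ = ∀ x → τ x ≡ τ′ x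

⟦⟧-cong : {τ τ′ : PathSub V W} {ρ ρ′ σ σ′ : Sub V W} →
  τ ≗ᵖ τ′ → ρ ≗ ρ′ → σ ≗ σ′ → (L : Term V) → L ⟦ τ ∶ ρ ∼ σ ⟧ ≡ L ⟦ τ′ ∶ ρ′ ∼ σ′ ⟧
⟦⟧-cong p q r (var x) = p x
⟦⟧-cong p q r bot     = refl
⟦⟧-cong p q r (φ ⊃ ψ) = cong₂ _⊃*_ (⟦⟧-cong p q r φ) (⟦⟧-cong p q r ψ)
⟦⟧-cong p q r (L · K) =
  cong₄ _·⟨_,_⟩_ (⟦⟧-cong p q r L) (sub-cong q K) (sub-cong r K) (⟦⟧-cong p q r K)
⟦⟧-cong p q r (ƛ A L) = cong (ƛ* A) (⟦⟧-cong
  (λ { (here refl) → refl ; (there x) → cong wk³ (p x) })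
  (λ { (here refl) → refl ; (there x) → cong wk³ (q x) })
  (λ { (here refl) → refl ; (there x) → cong wk³ (r x) }) L)

sub-⟦⟧ : (κ : Sub V W) {τ : PathSub U V} {ρ σ : Sub U V} (L : Term U) →
  sub κ (L ⟦ τ ∶ ρ ∼ σ ⟧) ≡ L ⟦ sub κ ∘ τ ∶ sub κ ∘ ρ ∼ sub κ ∘ σ ⟧
sub-⟦⟧ κ (var x) = refl
sub-⟦⟧ κ bot     = refl
sub-⟦⟧ κ (φ ⊃ ψ) = cong₂ _⊃*_ (sub-⟦⟧ κ φ) (sub-⟦⟧ κ ψ)
sub-⟦⟧ κ {ρ = ρ} {σ} (L · K) =
  cong₄ _·⟨_,_⟩_ (sub-⟦⟧ κ L) (sub-sub κ ρ K) (sub-sub κ σ K) (sub-⟦⟧ κ K)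
sub-⟦⟧ κ {τ} {ρ} {σ} (ƛ A L) = cong (ƛ* A) (trans (sub-⟦⟧ _ L) (⟦⟧-cong
  (λ { (here refl) → refl ; (there x) → wk³-sub κ (τ x) })
  (λ { (here refl) → refl ; (there x) → wk³-sub κ (ρ x) })
  (λ { (here refl) → refl ; (there x) → wk³-sub κ (σ x) }) L))

rename-⟦⟧ : (π : Ren V W) {τ : PathSub U V} {ρ σ : Sub U V} (L : Term U) →
  rename π (L ⟦ τ ∶ ρ ∼ σ ⟧) ≡ L ⟦ rename π ∘ τ ∶ rename π ∘ ρ ∼ rename π ∘ σ ⟧
rename-⟦⟧ π {τ} {ρ} {σ} L = begin
  rename π (L ⟦ τ ∶ ρ ∼ σ ⟧)         ≡⟨ rename≡sub π (L ⟦ τ ∶ ρ ∼ σ ⟧) ⟩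
  sub (var ∘ π) (L ⟦ τ ∶ ρ ∼ σ ⟧)    ≡⟨ sub-⟦⟧ (var ∘ π) L ⟩
  L ⟦ _ ∶ _ ∼ _ ⟧                    ≡⟨ ⟦⟧-cong (λ x → rename≡sub π (τ x))
                                          (λ x → rename≡sub π (ρ x))
                                          (λ x → rename≡sub π (σ x)) L ⟨
  L ⟦ _ ∶ _ ∼ _ ⟧                    ∎
  where open ≡-Reasoning

⟦⟧-rename : (π : Ren U V) {τ : PathSub V W} {ρ σ : Sub V W} (L : Term U) →
  rename π L ⟦ τ ∶ ρ ∼ σ ⟧ ≡ L ⟦ τ ∘ π ∶ ρ ∘ π ∼ σ ∘ π ⟧
⟦⟧-rename π (var x) = refl
⟦⟧-rename π bot     = refl
⟦⟧-rename π (φ ⊃ ψ) = cong₂ _⊃*_ (⟦⟧-rename π φ) (⟦⟧-rename π ψ)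
⟦⟧-rename π {ρ = ρ} {σ} (L · K) =
  cong₄ _·⟨_,_⟩_ (⟦⟧-rename π L) (sub-rename ρ π K) (sub-rename σ π K) (⟦⟧-rename π K)
⟦⟧-rename π (ƛ A L) = cong (ƛ* A) (trans (⟦⟧-rename (liftRen π) L) (⟦⟧-cong
  (λ { (here refl) → refl ; (there x) → refl })
  (λ { (here refl) → refl ; (there x) → refl })
  (λ { (here refl) → refl ; (there x) → refl }) L))

-- A term put in place of a variable before the path substitution is itself turned into a path,
-- while the two endpoint substitutions merely compose with κ. Under ƛ the weakened κ x avoids the
-- new variable, so `wk³` can be pulled out of its path.
⟦⟧-sub : (κ : Sub U V) {τ : PathSub V W} {ρ σ : Sub V W} (L : Term U) →
  sub κ L ⟦ τ ∶ ρ ∼ σ ⟧ ≡ L ⟦ (λ x → κ x ⟦ τ ∶ ρ ∼ σ ⟧) ∶ sub ρ ∘ κ ∼ sub σ ∘ κ ⟧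
⟦⟧-sub κ (var x) = refl
⟦⟧-sub κ bot     = refl
⟦⟧-sub κ (φ ⊃ ψ) = cong₂ _⊃*_ (⟦⟧-sub κ φ) (⟦⟧-sub κ ψ)
⟦⟧-sub κ {ρ = ρ} {σ} (L · K) =
  cong₄ _·⟨_,_⟩_ (⟦⟧-sub κ L) (sub-sub ρ κ K) (sub-sub σ κ K) (⟦⟧-sub κ K)
⟦⟧-sub κ {τ} {ρ} {σ} (ƛ A L) = cong (ƛ* A) (trans (⟦⟧-sub (liftSub κ) L) (⟦⟧-cong
  (λ { (here refl) → refl
     ; (there x) → trans (⟦⟧-rename there (κ x)) (sym (rename-⟦⟧ _ (κ x))) })
  (λ { (here refl) → refl
     ; (there x) → trans (sub-rename _ there (κ x)) (sym (rename-sub _ ρ (κ x))) })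
  (λ { (here refl) → refl
     ; (there x) → trans (sub-rename _ there (κ x)) (sym (rename-sub _ σ (κ x))) }) L))

-- The paper's L{}, with nothing substituted.
infix 40 _⟦⟧

_⟦⟧ : Term V → Path V
L ⟦⟧ = L ⟦ ref ∘ var ∶ var ∼ var ⟧

rename-⟦⟧₀ : (π : Ren V W) (L : Term V) → rename π (L ⟦⟧) ≡ rename π L ⟦⟧
rename-⟦⟧₀ π L = trans (rename-⟦⟧ π L) (sym (⟦⟧-rename π L))

⟦⟧₀-sub : (κ : Sub V W) (L : Term V) →
  sub κ L ⟦⟧ ≡ L ⟦ (λ x → κ x ⟦⟧) ∶ κ ∼ κ ⟧
⟦⟧₀-sub κ L = trans (⟦⟧-sub κ L)
  (⟦⟧-cong (λ _ → refl) (λ x → sub-id (κ x)) (λ x → sub-id (κ x)) L)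

-- This is the contractum of `refƛ` when κ is applied before the step: x goes to `κ x ⟦⟧`. Applying
-- κ after the step would give `ref (κ x)`, and this mismatch is what breaks stability of `refƛ`
-- under substitution.
⟦∶≈⟧-sub : (κ : Sub U V) (L : Term (term ∷ U)) (P : Path V) (M N : Term V) →
  sub (liftSub κ) L ⟦ P ∶ M ≈ N ⟧ ≡
  L ⟦ (λ x → κ x ⟦⟧) ◂ᵖ P ∶ κ ◂ M ∼ κ ◂ N ⟧
⟦∶≈⟧-sub κ L P M N = trans (⟦⟧-sub (liftSub κ) L) (⟦⟧-cong
  (λ { (here refl) → refl ; (there x) → ⟦⟧-rename there (κ x) })
  (λ { (here refl) → refl ; (there x) → trans (sub-◂-wk var M (κ x)) (sub-id (κ x)) })
  (λ { (here refl) → refl ; (there x) → trans (sub-◂-wk var N (κ x)) (sub-id (κ x)) }) L)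

[]-⟦⟧ : (M : Term (term ∷ V)) (N : Term V) {τ : PathSub V W} {ρ σ : Sub V W} →
  M [ N ] ⟦ τ ∶ ρ ∼ σ ⟧ ≡ M ⟦ τ ◂ᵖ N ⟦ τ ∶ ρ ∼ σ ⟧ ∶ ρ ◂ sub ρ N ∼ σ ◂ sub σ N ⟧
[]-⟦⟧ M N = trans (⟦⟧-sub (var ◂ N) M) (⟦⟧-cong
  (λ { (here refl) → refl ; (there x) → refl })
  (λ { (here refl) → refl ; (there x) → refl })
  (λ { (here refl) → refl ; (there x) → refl }) M)

sub³-⟦⟧ : (κ : Sub V W) (M N : Term W) (Q : Path W) {τ : PathSub U V} {ρ σ : Sub U V}
  (L : Term (term ∷ U)) →
  sub (κ ◂ M ◂ N ◂ Q) (L ⟦ (wk³ ∘ τ) ◂ᵖ var v₀ ∶ (wk³ ∘ ρ) ◂ var v₂ ∼ (wk³ ∘ σ) ◂ var v₁ ⟧)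
  ≡ L ⟦ (sub κ ∘ τ) ◂ᵖ Q ∶ (sub κ ∘ ρ) ◂ M ∼ (sub κ ∘ σ) ◂ N ⟧
sub³-⟦⟧ κ M N Q {τ} {ρ} {σ} L = trans (sub-⟦⟧ _ L) (⟦⟧-cong
  (λ { (here refl) → refl ; (there x) → sub-rename _ _ (τ x) })
  (λ { (here refl) → refl ; (there x) → sub-rename _ _ (ρ x) })
  (λ { (here refl) → refl ; (there x) → sub-rename _ _ (σ x) }) L)

-- Reduction under renaming and substitution, confluence for terms

⟶-≡ : {E F F′ : Expr V k} → E ⟶ F → F ≡ F′ → E ⟶ F′
⟶-≡ r refl = r

-- Reduction is not closed under substitution of terms in paths (refƛ is not stable),
-- but it is closed under renaming.
rename-⟶ : (ρ : Ren V W) {E F : Expr V k} → E ⟶ F → rename ρ E ⟶ rename ρ F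
rename-⟶ ρ (β {A} {M} {N}) = ⟶-≡ β eq
  where
  eq : rename (liftRen ρ) M [ rename ρ N ] ≡ rename ρ (M [ N ])
  eq = trans (sub-rename _ (liftRen ρ) M) (trans
    (sub-cong (λ { (here refl) → refl ; (there x) → refl }) M) (sym (rename-sub ρ _ M)))
rename-⟶ ρ (·ˡ r)    = ·ˡ (rename-⟶ ρ r)
rename-⟶ ρ (⊃ˡ r)    = ⊃ˡ (rename-⟶ ρ r)
rename-⟶ ρ (⊃ʳ r)    = ⊃ʳ (rename-⟶ ρ r)
rename-⟶ ρ (βₚ {φ} {δ} {ε}) = ⟶-≡ βₚ eq
  where
  eq : rename (liftRen ρ) δ [ rename ρ ε ] ≡ rename ρ (δ [ ε ])
  eq = trans (sub-rename _ (liftRen ρ) δ) (trans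
    (sub-cong (λ { (here refl) → refl ; (there x) → refl }) δ) (sym (rename-sub ρ _ δ)))
rename-⟶ ρ ref⁺      = ref⁺
rename-⟶ ρ ref⁻      = ref⁻
rename-⟶ ρ univ⁺     = univ⁺
rename-⟶ ρ univ⁻     = univ⁻
rename-⟶ ρ (∙ˡ r)    = ∙ˡ (rename-⟶ ρ r)
rename-⟶ ρ (⁺-cong r) = ⁺-cong (rename-⟶ ρ r)
rename-⟶ ρ (⁻-cong r) = ⁻-cong (rename-⟶ ρ r)
rename-⟶ ρ (β* {A} {P} {M} {N} {Q}) = ⟶-≡ β* eq
  where
  eq : sub (var ◂ rename ρ M ◂ rename ρ N ◂ rename ρ Q)
         (rename (liftRen (liftRen (liftRen ρ))) P) ≡ rename ρ (sub (var ◂ M ◂ N ◂ Q) P)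
  eq = trans (sub-rename _ _ P) (trans
    (sub-cong (λ { (here refl) → refl ; (there (here refl)) → refl
                 ; (there (there (here refl))) → refl ; (there (there (there x))) → refl }) P)
    (sym (rename-sub ρ _ P)))
rename-⟶ ρ (refƛ {A} {M} {N} {N′} {P}) = ⟶-≡ refƛ eq
  where
  eq : rename (liftRen ρ) M ⟦ rename ρ P ∶ rename ρ N ≈ rename ρ N′ ⟧ ≡
       rename ρ (M ⟦ P ∶ N ≈ N′ ⟧)
  eq = trans (⟦⟧-rename (liftRen ρ) M) (trans (⟦⟧-cong
    (λ { (here refl) → refl ; (there x) → refl })
    (λ { (here refl) → refl ; (there x) → refl })
    (λ { (here refl) → refl ; (there x) → refl }) M) (sym (rename-⟦⟧ ρ M)))
rename-⟶ ρ ref⊃*ref  = ref⊃*ref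
rename-⟶ ρ (ref⊃*univ {φ} {ψ} {χ} {δ} {ε})
  rewrite wk-rename {l = proof} (liftRen {l = proof} ρ) (wk δ) | wk-rename {l = proof} ρ δ
        | wk-rename {l = proof} (liftRen {l = proof} ρ) (wk ε) | wk-rename {l = proof} ρ ε
        | wk-rename {l = proof} ρ φ
  = ref⊃*univ
rename-⟶ ρ (univ⊃*ref {φ} {ψ} {χ} {δ} {ε})
  rewrite wk-rename {l = proof} (liftRen {l = proof} ρ) (wk δ) | wk-rename {l = proof} ρ δ
        | wk-rename {l = proof} (liftRen {l = proof} ρ) (wk ε) | wk-rename {l = proof} ρ ε
        | wk-rename {l = proof} ρ φ | wk-rename {l = proof} ρ ψ
  = univ⊃*ref
rename-⟶ ρ (univ⊃*univ {φ} {ψ} {δ} {ε} {φ′} {ψ′} {δ′} {ε′})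
  rewrite wk-rename {l = proof} (liftRen {l = proof} ρ) (wk δ) | wk-rename {l = proof} ρ δ
        | wk-rename {l = proof} (liftRen {l = proof} ρ) (wk ε) | wk-rename {l = proof} ρ ε
        | wk-rename {l = proof} (liftRen {l = proof} ρ) (wk δ′) | wk-rename {l = proof} ρ δ′
        | wk-rename {l = proof} (liftRen {l = proof} ρ) (wk ε′) | wk-rename {l = proof} ρ ε′
        | wk-rename {l = proof} ρ φ | wk-rename {l = proof} ρ ψ
  = univ⊃*univ
rename-⟶ ρ (·*ˡ r)   = ·*ˡ (rename-⟶ ρ r)
rename-⟶ ρ (ref·* r) = ref·* (rename-⟶ ρ r)
rename-⟶ ρ (⊃*ˡ r)   = ⊃*ˡ (rename-⟶ ρ r)
rename-⟶ ρ (⊃*ʳ r)   = ⊃*ʳ (rename-⟶ ρ r)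

sub-⟶ : (σ : Sub V W) {M N : Term V} → M ⟶ N → sub σ M ⟶ sub σ N
sub-⟶ σ (β {M = M} {N}) = ⟶-≡ β (sym (sub-[] σ M N))
sub-⟶ σ (·ˡ r) = ·ˡ (sub-⟶ σ r)
sub-⟶ σ (⊃ˡ r) = ⊃ˡ (sub-⟶ σ r)
sub-⟶ σ (⊃ʳ r) = ⊃ʳ (sub-⟶ σ r)

-- Every term rule has a path rule as its mirror image: β becomes `β*`, and by `[]-⟦⟧` the two
-- contracta correspond. This lets computability of `M ⟦⟧` be pulled back along reductions of M.
⟦⟧-⟶ : {τ : PathSub V W} {ρ σ : Sub V W} {M N : Term V} →
  M ⟶ N → M ⟦ τ ∶ ρ ∼ σ ⟧ ⟶ N ⟦ τ ∶ ρ ∼ σ ⟧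
⟦⟧-⟶ {τ = τ} {ρ} {σ} (β {A} {M} {N}) = 
  ⟶-≡ β* (trans (sub³-⟦⟧ var (sub ρ N) (sub σ N) (N ⟦ τ ∶ ρ ∼ σ ⟧) {τ} {ρ} {σ} M)
    (trans (⟦⟧-cong
      (λ { (here refl) → refl ; (there x) → sub-id (τ x) })
      (λ { (here refl) → refl ; (there x) → sub-id (ρ x) })
      (λ { (here refl) → refl ; (there x) → sub-id (σ x) }) M)
    (sym ([]-⟦⟧ M N))))
⟦⟧-⟶ (·ˡ r) = ·*ˡ (⟦⟧-⟶ r)
⟦⟧-⟶ (⊃ˡ r) = ⊃*ˡ (⟦⟧-⟶ r)
⟦⟧-⟶ (⊃ʳ r) = ⊃*ʳ (⟦⟧-⟶ r)

-- An abstraction does not reduce, so β never competes with `·ˡ`, and only ⊃ offers two independent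
-- redexes. Equality is a separate outcome because equal contracta may be normal and then have no
-- common one-step reduct.
diamond : {M N N′ : Term V} → M ⟶ N → M ⟶ N′ →
  N ≡ N′ ⊎ ∃[ R ] (N ⟶ R × N′ ⟶ R)
diamond β      β      = inj₁ refl
diamond (·ˡ r) (·ˡ s) with diamond r s
... | inj₁ refl          = inj₁ refl
... | inj₂ (R , r′ , s′) = inj₂ (R · _ , ·ˡ r′ , ·ˡ s′)
diamond (⊃ˡ r) (⊃ˡ s) with diamond r s
... | inj₁ refl          = inj₁ refl
... | inj₂ (R , r′ , s′) = inj₂ (R ⊃ _ , ⊃ˡ r′ , ⊃ˡ s′)
diamond (⊃ˡ r) (⊃ʳ s) = inj₂ (_ , ⊃ʳ s , ⊃ˡ r)
diamond (⊃ʳ r) (⊃ˡ s) = inj₂ (_ , ⊃ˡ s , ⊃ʳ r)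
diamond (⊃ʳ r) (⊃ʳ s) with diamond r s
... | inj₁ refl          = inj₁ refl
... | inj₂ (R , r′ , s′) = inj₂ (_ ⊃ R , ⊃ʳ r′ , ⊃ʳ s′)

strip : {M N N′ : Term V} → M ⟶ N → M ↠ N′ → ∃[ R ] (N ↠ R × N′ ↠ R)
strip r nil        = _ , nil , r ◅ nil
strip r (s ◅ ss) with diamond r s
... | inj₁ refl          = _ , ss , nil
... | inj₂ (R , r′ , s′) with strip s′ ss
...   | R′ , rs , ss′ = R′ , r′ ◅ rs , ss′

confluent : Confluent (_⟶_ {V} {term})
confluent nil        ss = _ , ss , nil
confluent (r ◅ rs) ss with strip r ss
... | R , rs′ , ss′ with confluent rs rs′
...   | R′ , rs″ , ss″ = R′ , rs″ , ss′ ◅◅ ss″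

church-rosser : {M N : Term V} → M ≃ N → ∃[ R ] (M ↠ R × N ↠ R)
church-rosser nil            = _ , nil , nil
church-rosser (fwd r ◅ rs) with church-rosser rs
... | R , ss , ts = R , r ◅ ss , ts
church-rosser (bwd r ◅ rs) with church-rosser rs
... | R , ss , ts with strip r ss
...   | R′ , ss′ , ts′ = R′ , ss′ , ts ◅◅ ts′

⊃-↠⁻¹ : {φ ψ χ : Term V} → φ ⊃ ψ ↠ χ → ∃[ φ′ ] ∃[ ψ′ ] (χ ≡ φ′ ⊃ ψ′ × φ ↠ φ′ × ψ ↠ ψ′)
⊃-↠⁻¹ nil           = _ , _ , refl , nil , nil
⊃-↠⁻¹ (⊃ˡ r ◅ rs) with ⊃-↠⁻¹ rs
... | _ , _ , eq , ss , ts = _ , _ , eq , r ◅ ss , ts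
⊃-↠⁻¹ (⊃ʳ r ◅ rs) with ⊃-↠⁻¹ rs
... | _ , _ , eq , ss , ts = _ , _ , eq , ss , r ◅ ts

-- A common reduct of two implications is again an implication, reached componentwise.
⊃-injective : {φ φ′ ψ ψ′ : Term V} → φ ⊃ ψ ≃ φ′ ⊃ ψ′ → φ ≃ φ′ × ψ ≃ ψ′
⊃-injective eq with church-rosser eq
... | _ , rs , ss with ⊃-↠⁻¹ rs | ⊃-↠⁻¹ ss
...   | _ , _ , refl , rs₁ , rs₂ | _ , _ , refl , ss₁ , ss₂ =
        a—↠b⇒a↔b rs₁ ◅◅ a—↠b⇒b↔a ss₁ , a—↠b⇒a↔b rs₂ ◅◅ a—↠b⇒b↔a ss₂

rename-↠ : (ρ : Ren V W) {E F : Expr V k} → E ↠ F → rename ρ E ↠ rename ρ F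
rename-↠ ρ = gmap (rename ρ) (rename-⟶ ρ)

rename-≃ : (ρ : Ren V W) {E F : Expr V k} → E ≃ F → rename ρ E ≃ rename ρ F
rename-≃ ρ = Eq.gmap (rename ρ) (rename-⟶ ρ)

sub-≃ : (σ : Sub V W) {M N : Term V} → M ≃ N → sub σ M ≃ sub σ N
sub-≃ σ = Eq.gmap (sub σ) (sub-⟶ σ)

·-≃ˡ : {M M′ N : Term V} → M ≃ M′ → M · N ≃ M′ · N
·-≃ˡ = Eq.gmap (_· _) ·ˡ

⊃-↠ : {φ φ′ ψ ψ′ : Term V} → φ ↠ φ′ → ψ ↠ ψ′ → φ ⊃ ψ ↠ φ′ ⊃ ψ′
⊃-↠ rs ss = gmap (_⊃ _) ⊃ˡ rs ◅◅ gmap (_ ⊃_) ⊃ʳ ss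

-- Normal forms of propositions

infixr 25 _⊃ⁿ_

-- Kept free of scopes, so that renaming and substitution leave the index of the interpretation
-- fixed and `Cₚ` can recurse on it structurally.
data NfProp : Set where
  ⊥ⁿ   : NfProp
  _⊃ⁿ_ : NfProp → NfProp → NfProp

⌜_⌝ : NfProp → Term V
⌜ ⊥ⁿ ⌝      = bot
⌜ θ ⊃ⁿ θ′ ⌝ = ⌜ θ ⌝ ⊃ ⌜ θ′ ⌝

⌜⌝-normal : (θ : NfProp) → IsNormalForm _⟶_ (⌜_⌝ {V} θ)
⌜⌝-normal (θ ⊃ⁿ θ′) (_ , ⊃ˡ r) = ⌜⌝-normal θ (_ , r)
⌜⌝-normal (θ ⊃ⁿ θ′) (_ , ⊃ʳ r) = ⌜⌝-normal θ′ (_ , r)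

⌜⌝-injective : (θ θ′ : NfProp) → ⌜_⌝ {V} θ ≡ ⌜ θ′ ⌝ → θ ≡ θ′
⌜⌝-injective ⊥ⁿ         ⊥ⁿ         eq = refl
⌜⌝-injective (θ₁ ⊃ⁿ θ₂) (θ₃ ⊃ⁿ θ₄) eq with ⊃-≡ eq
  where
  ⊃-≡ : {φ φ′ ψ ψ′ : Term V} → φ ⊃ ψ ≡ φ′ ⊃ ψ′ → φ ≡ φ′ × ψ ≡ ψ′
  ⊃-≡ refl = refl , refl
... | eq₁ , eq₂ = cong₂ _⊃ⁿ_ (⌜⌝-injective θ₁ θ₃ eq₁) (⌜⌝-injective θ₂ θ₄ eq₂)

rename-⌜⌝ : (ρ : Ren V W) (θ : NfProp) → rename ρ ⌜ θ ⌝ ≡ ⌜ θ ⌝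
rename-⌜⌝ ρ ⊥ⁿ        = refl
rename-⌜⌝ ρ (θ ⊃ⁿ θ′) = cong₂ _⊃_ (rename-⌜⌝ ρ θ) (rename-⌜⌝ ρ θ′)

infix 10 _⇓_

_⇓_ : Term V → NfProp → Set
φ ⇓ θ = φ ↠ ⌜ θ ⌝

⇓-≃ : {φ ψ : Term V} {θ : NfProp} → φ ≃ ψ → φ ⇓ θ → ψ ⇓ θ
⇓-≃ {θ = θ} eq rs =
  conf⇒nf confluent (⌜⌝-normal θ) (symmetric _ eq ◅◅ a—↠b⇒a↔b rs)

-- Makes the interpretation of a proposition well defined: when two premises of a rule speak of the
-- same proposition, the normal forms supplied with them can be identified.
⇓-unique : {φ : Term V} {θ θ′ : NfProp} → φ ⇓ θ → φ ⇓ θ′ → θ ≡ θ′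
⇓-unique {θ = θ} {θ′} rs ss = ⌜⌝-injective θ θ′
  (conf⇒unf confluent (⌜⌝-normal θ) (⌜⌝-normal θ′) (a—↠b⇒b↔a rs ◅◅ a—↠b⇒a↔b ss))

⇓-rename : (ρ : Ren V W) {φ : Term V} {θ : NfProp} → φ ⇓ θ → rename ρ φ ⇓ θ
⇓-rename ρ {θ = θ} rs = subst (_ ↠_) (rename-⌜⌝ ρ θ) (rename-↠ ρ rs)

⇓-⊃⁻¹ : {φ ψ : Term V} (θ : NfProp) → φ ⊃ ψ ⇓ θ →
  ∃[ θ₁ ] ∃[ θ₂ ] (θ ≡ θ₁ ⊃ⁿ θ₂ × φ ⇓ θ₁ × ψ ⇓ θ₂)
⇓-⊃⁻¹ ⊥ⁿ         rs with ⊃-↠⁻¹ rs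
... | _ , _ , () , _
⇓-⊃⁻¹ (θ₁ ⊃ⁿ θ₂) rs with ⊃-↠⁻¹ rs
... | _ , _ , refl , rs₁ , rs₂ = θ₁ , θ₂ , refl , rs₁ , rs₂

-- Computability predicates and their closure properties

rename-neutralPath : (ρ : Ren V W) {P : Path V} → NeutralPath P → NeutralPath (rename ρ P)
rename-neutralPath ρ (var e)  = var (ρ e)
rename-neutralPath ρ (⊃*ˡ n)  = ⊃*ˡ (rename-neutralPath ρ n)
rename-neutralPath ρ (⊃*ʳ n)  = ⊃*ʳ (rename-neutralPath ρ n)
rename-neutralPath ρ (app* n) = app* (rename-neutralPath ρ n)

rename-neutralProof : (ρ : Ren V W) {δ : Proof V} → NeutralProof δ → NeutralProof (rename ρ δ)
rename-neutralProof ρ (var p) = var (ρ p)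
rename-neutralProof ρ (n ⁺)   = rename-neutralPath ρ n ⁺
rename-neutralProof ρ (n ⁻)   = rename-neutralPath ρ n ⁻
rename-neutralProof ρ (app n) = app (rename-neutralProof ρ n)

-- Nothing is asked of the body ε. Its behaviour is covered by the application clause of `Cₚ`, and
-- its typing comes later from subject reduction.
data LamProof {V} (δ : Proof V) : Set where
  neutral : ∀ {ν} → δ ↠ ν → NeutralProof ν → LamProof δ
  lam     : ∀ {φ ε} → δ ↠ ƛₚ φ ε → LamProof δ

Cₚ : NfProp → Proof V → Set
Cₚ ⊥ⁿ            δ = ∃[ ν ] (δ ↠ ν × NeutralProof ν)
Cₚ {V} (θ ⊃ⁿ θ′) δ =
  LamProof δ × (∀ {W} (ρ : Ren V W) (ε : Proof W) → Cₚ θ ε → Cₚ θ′ (rename ρ δ ∙ ε))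

-- The two indices must agree for `ref`, because `ref χ ⁺` and `ref χ ⁻` reduce to identities, which
-- have to map the interpretation of θ into that of θ′ and back.
data CΩ {V} (θ θ′ : NfProp) (P : Path V) : Set where
  neutral : ∀ {ν} → P ↠ ν → NeutralPath ν → CΩ θ θ′ P
  ref     : ∀ {χ} → P ↠ ref χ → θ ≡ θ′ → CΩ θ θ′ P
  univ    : ∀ {φ ψ δ ε} → P ↠ univ φ ψ δ ε → Cₚ (θ ⊃ⁿ θ′) δ → Cₚ (θ′ ⊃ⁿ θ) ε → CΩ θ θ′ P

data LamPath {V} (P : Path V) : Set where
  neutral : ∀ {ν} → P ↠ ν → NeutralPath ν → LamPath P
  ref     : ∀ {M} → P ↠ ref M → LamPath P
  lam     : ∀ {A Q} → P ↠ ƛ* A Q → LamPath P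

-- C demands that both M{} and ref(M) be computable: a β-step of ref(λx.L[κ]) yields
-- L{y := (κ y){}, x := Q}, with (κ y){} and not ref(κ y) in the place of y.

C₀ : Ty → Term V → Set
C  : Ty → Term V → Set
C* : Ty → Term V → Term V → Path V → Set

C A M = C₀ A M × C* A M M (M ⟦⟧) × C* A M M (ref M)

C₀ Ω M           = ∃[ θ ] (M ⇓ θ)
C₀ {V} (A ⇒ B) M = ∀ {W} (ρ : Ren V W) (N : Term W) → C A N → C B (rename ρ M · N)

C* Ω           M M′ P = ∃[ θ ] ∃[ θ′ ] (M ⇓ θ × M′ ⇓ θ′ × CΩ θ θ′ P)
C* {V} (A ⇒ B) M M′ P = LamPath P ×
  (∀ {W} (ρ : Ren V W) (N N′ : Term W) (Q : Path W) →
    C A N → C A N′ → C* A N N′ Q →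
    C* B (rename ρ M · N) (rename ρ M′ · N′) (rename ρ P ·⟨ N , N′ ⟩ Q))

∙-↠ˡ : {δ δ′ ε : Proof V} → δ ↠ δ′ → δ ∙ ε ↠ δ′ ∙ ε
∙-↠ˡ = gmap (_∙ _) ∙ˡ

·*-↠ˡ : {P P′ Q : Path V} {M N : Term V} → P ↠ P′ → P ·⟨ M , N ⟩ Q ↠ P′ ·⟨ M , N ⟩ Q
·*-↠ˡ = gmap _ ·*ˡ

Cₚ-expand : (θ : NfProp) {δ δ′ : Proof V} → δ ↠ δ′ → Cₚ θ δ′ → Cₚ θ δ
Cₚ-expand ⊥ⁿ        rs (ν , ss , n) = ν , rs ◅◅ ss , n
Cₚ-expand (θ ⊃ⁿ θ′) rs (v , f) = lam-expand v ,
  λ ρ ε c → Cₚ-expand θ′ (∙-↠ˡ (rename-↠ ρ rs)) (f ρ ε c)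
  where
  lam-expand : LamProof _ → LamProof _
  lam-expand (neutral ss n) = neutral (rs ◅◅ ss) n
  lam-expand (lam ss)       = lam (rs ◅◅ ss)

Cₚ-rename : (θ : NfProp) (ρ : Ren V W) {δ : Proof V} → Cₚ θ δ → Cₚ θ (rename ρ δ)
Cₚ-rename ⊥ⁿ        ρ     (ν , rs , n) = rename ρ ν , rename-↠ ρ rs , rename-neutralProof ρ n
Cₚ-rename (θ ⊃ⁿ θ′) ρ {δ} (v , f) = lam-rename v ,
  λ π ε c → subst (λ δ′ → Cₚ θ′ (δ′ ∙ ε)) (sym (rename-rename π ρ δ)) (f (π ∘ ρ) ε c)
  where
  lam-rename : LamProof _ → LamProof _
  lam-rename (neutral rs n) = neutral (rename-↠ ρ rs) (rename-neutralProof ρ n)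
  lam-rename (lam rs)       = lam (rename-↠ ρ rs)

Cₚ-neutral : (θ : NfProp) {ν : Proof V} → NeutralProof ν → Cₚ θ ν
Cₚ-neutral ⊥ⁿ        n = _ , nil , n
Cₚ-neutral (θ ⊃ⁿ θ′) n = neutral nil n ,
  λ ρ ε c → Cₚ-neutral θ′ (app (rename-neutralProof ρ n))

Cₚ-app : (θ θ′ : NfProp) {δ ε : Proof V} → Cₚ (θ ⊃ⁿ θ′) δ → Cₚ θ ε → Cₚ θ′ (δ ∙ ε)
Cₚ-app θ θ′ {δ} {ε} (_ , f) c =
  subst (λ δ′ → Cₚ θ′ (δ′ ∙ ε)) (rename-id δ) (f (λ x → x) ε c)

sub-◂-liftRen : (σ : Sub V W) (F : Expr W l) (ρ : Ren U V) (E : Expr (l ∷ U) k) →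
  sub (σ ◂ F) (rename (liftRen ρ) E) ≡ sub ((σ ∘ ρ) ◂ F) E
sub-◂-liftRen σ F ρ E = trans (sub-rename _ _ E)
  (sub-cong (λ { (here refl) → refl ; (there x) → refl }) E)

Cₚ-ƛ : (θ θ′ : NfProp) {φ : Term V} {δ : Proof (proof ∷ V)} →
  (∀ {W} (ρ : Ren V W) (ε : Proof W) → Cₚ θ ε → Cₚ θ′ (sub ((var ∘ ρ) ◂ ε) δ)) →
  Cₚ (θ ⊃ⁿ θ′) (ƛₚ φ δ)
Cₚ-ƛ θ θ′ {δ = δ} f = lam nil , λ ρ ε c → Cₚ-expand θ′
  (⟶-≡ βₚ (sub-◂-liftRen var ε ρ δ) ◅ nil) (f ρ ε c)

CΩ-expand : {θ θ′ : NfProp} {P Q : Path V} → P ↠ Q → CΩ θ θ′ Q → CΩ θ θ′ P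
CΩ-expand rs (neutral ss n)  = neutral (rs ◅◅ ss) n
CΩ-expand rs (ref ss eq)     = ref (rs ◅◅ ss) eq
CΩ-expand rs (univ ss c d)   = univ (rs ◅◅ ss) c d

CΩ-rename : {θ θ′ : NfProp} (ρ : Ren V W) {P : Path V} → CΩ θ θ′ P → CΩ θ θ′ (rename ρ P)
CΩ-rename ρ (neutral rs n) = neutral (rename-↠ ρ rs) (rename-neutralPath ρ n)
CΩ-rename ρ (ref rs eq)    = ref (rename-↠ ρ rs) eq
CΩ-rename ρ (univ rs c d)  = univ (rename-↠ ρ rs) (Cₚ-rename (_ ⊃ⁿ _) ρ c) (Cₚ-rename (_ ⊃ⁿ _) ρ d)

C*-≡ : (A : Ty) {M M′ N N′ : Term V} {P P′ : Path V} →
  M ≡ M′ → N ≡ N′ → P ≡ P′ → C* A M N P → C* A M′ N′ P′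
C*-≡ A refl refl refl c = c

C*-expand : (A : Ty) {M M′ : Term V} {P Q : Path V} → P ↠ Q → C* A M M′ Q → C* A M M′ P
C*-expand Ω       rs (_ , _ , r , s , c) = _ , _ , r , s , CΩ-expand rs c
C*-expand (A ⇒ B) rs (v , f) = lam-expand v ,
  λ ρ N N′ Q c c′ d → C*-expand B (·*-↠ˡ (rename-↠ ρ rs)) (f ρ N N′ Q c c′ d)
  where
  lam-expand : LamPath _ → LamPath _
  lam-expand (neutral ss n) = neutral (rs ◅◅ ss) n
  lam-expand (ref ss)       = ref (rs ◅◅ ss)
  lam-expand (lam ss)       = lam (rs ◅◅ ss)

C*-rename : (A : Ty) (ρ : Ren V W) {M M′ : Term V} {P : Path V} →
  C* A M M′ P → C* A (rename ρ M) (rename ρ M′) (rename ρ P)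
C*-rename Ω       ρ (θ , θ′ , r , s , c) =
  θ , θ′ , ⇓-rename ρ {θ = θ} r , ⇓-rename ρ {θ = θ′} s , CΩ-rename ρ c
C*-rename (A ⇒ B) ρ {M} {M′} {P} (v , f) = lam-rename v , λ π N N′ Q c c′ d →
  C*-≡ B (cong (_· N) (sym (rename-rename π ρ M))) (cong (_· N′) (sym (rename-rename π ρ M′)))
    (cong (_·⟨ N , N′ ⟩ Q) (sym (rename-rename π ρ P))) (f (π ∘ ρ) N N′ Q c c′ d)
  where
  lam-rename : LamPath _ → LamPath _
  lam-rename (neutral rs n) = neutral (rename-↠ ρ rs) (rename-neutralPath ρ n)
  lam-rename (ref rs)       = ref (rename-↠ ρ rs)
  lam-rename (lam rs)       = lam (rename-↠ ρ rs)

-- The endpoints matter only through the normal forms of their applications at Ω, and these are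
-- invariant under ≃.
C*-≃ : (A : Ty) {M M′ N N′ : Term V} {P : Path V} →
  M ≃ M′ → N ≃ N′ → C* A M N P → C* A M′ N′ P
C*-≃ Ω       eq eq′ (θ , θ′ , r , s , c) = θ , θ′ , ⇓-≃ {θ = θ} eq r , ⇓-≃ {θ = θ′} eq′ s , c
C*-≃ (A ⇒ B) eq eq′ (v , f) = v , λ ρ N N′ Q c c′ d →
  C*-≃ B (·-≃ˡ (rename-≃ ρ eq)) (·-≃ˡ (rename-≃ ρ eq′)) (f ρ N N′ Q c c′ d)

-- A neutral path carries no information about its endpoints, so their normal forms at Ω must come
-- from the computability of M and M′.
C*-neutral : (A : Ty) {M M′ : Term V} {ν : Path V} →
  NeutralPath ν → C₀ A M → C₀ A M′ → C* A M M′ ν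
C*-neutral Ω       n (_ , r) (_ , s) = _ , _ , r , s , neutral nil n
C*-neutral (A ⇒ B) n f g = neutral nil n , λ ρ N N′ Q c c′ d →
  C*-neutral B (app* (rename-neutralPath ρ n)) (proj₁ (f ρ N c)) (proj₁ (g ρ N′ c′))

C*-app : (A B : Ty) {M M′ N N′ : Term V} {P Q : Path V} →
  C* (A ⇒ B) M M′ P → C A N → C A N′ → C* A N N′ Q → C* B (M · N) (M′ · N′) (P ·⟨ N , N′ ⟩ Q)
C*-app A B {M} {M′} {N} {N′} {P} {Q} (_ , f) c c′ d = C*-≡ B
  (cong (_· N) (rename-id M)) (cong (_· N′) (rename-id M′)) (cong (_·⟨ N , N′ ⟩ Q) (rename-id P))
  (f (λ x → x) N N′ Q c c′ d)

⟦⟧-↠ : {M N : Term V} → M ↠ N → M ⟦⟧ ↠ N ⟦⟧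
⟦⟧-↠ = gmap _⟦⟧ ⟦⟧-⟶

C₀-rename : (A : Ty) (ρ : Ren V W) {M : Term V} → C₀ A M → C₀ A (rename ρ M)
C₀-rename Ω       ρ (θ , r) = θ , ⇓-rename ρ {θ = θ} r
C₀-rename (A ⇒ B) ρ {M} f π N c =
  subst (λ M′ → C B (M′ · N)) (sym (rename-rename π ρ M)) (f (π ∘ ρ) N c)

C-rename : (A : Ty) (ρ : Ren V W) {M : Term V} → C A M → C A (rename ρ M)
C-rename A ρ {M} (c , d , d′) = C₀-rename A ρ c
  , subst (C* A _ _) (rename-⟦⟧₀ ρ M) (C*-rename A ρ d) , C*-rename A ρ d′

-- The last component needs its own argument, `cref`, because `ref M` does not reduce to `ref M′`.
-- At Ω it is already a value; at an arrow the step becomes available through `ref·*` once the path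
-- is applied.
C-expand : (A : Ty) {M M′ : Term V} → M ↠ M′ → C A M′ → C A M
C-expand {V} A {M} {M′} rs (c , d , d′) = c₀ A c
  , C*-≃ A eq eq (C*-expand A (⟦⟧-↠ rs) d) , cref A d′
  where
  eq : M′ ≃ M
  eq = a—↠b⇒b↔a rs
  c₀ : ∀ A → C₀ A M′ → C₀ A M
  c₀ Ω       (θ , ss) = θ , rs ◅◅ ss
  c₀ (A ⇒ B) f ρ N c = C-expand B (gmap (_· N) ·ˡ (rename-↠ ρ rs)) (f ρ N c)
  cref : ∀ A → C* A M′ M′ (ref M′) → C* A M M (ref M)
  cref Ω       (θ , _ , r , _ , _) = θ , θ , rs ◅◅ r , rs ◅◅ r , ref nil refl
  cref (A ⇒ B) (_ , f) = ref nil , λ ρ N N′ Q c c′ d →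
    C*-≃ B (·-≃ˡ (rename-≃ ρ eq)) (·-≃ˡ (rename-≃ ρ eq))
      (C*-expand B (gmap (λ M → ref M ·⟨ N , N′ ⟩ Q) ref·* (rename-↠ ρ rs)) (f ρ N N′ Q c c′ d))

C-app : (A B : Ty) {M N : Term V} → C₀ (A ⇒ B) M → C A N → C B (M · N)
C-app A B {M} {N} f c = subst (λ M → C B (M · N)) (rename-id M) (f (λ x → x) N c)

rename-lift-sub : (π : Ren V W) (σ : Sub U V) (E : Expr (l ∷ U) k) →
  rename (liftRen π) (sub (liftSub σ) E) ≡ sub (liftSub (rename π ∘ σ)) E
rename-lift-sub π σ E = trans (rename-sub (liftRen π) (liftSub σ) E)
  (sub-cong (λ { (here refl) → refl ; (there x) → wk-rename π (σ x) }) E)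

ƛ-β : (π : Ren V W) (σ : Sub U V) (A : Ty) (L : Term (term ∷ U)) (N : Term W) →
  rename π (sub σ (ƛ A L)) · N ⟶ sub ((rename π ∘ σ) ◂ N) L
ƛ-β π σ A L N = ⟶-≡ β (trans (cong (_[ N ]) (rename-lift-sub π σ L)) (trans
  (sub-lift-◂ var N (rename π ∘ σ) L)
  (sub-cong (λ { (here refl) → refl ; (there x) → sub-id (rename π (σ x)) }) L)))

-- Typing of terms, well-formed contexts and classes

typeAt : Ctx V → term ∈ V → Ty
typeAt (Γ ▹ T)    (there x)   = typeAt Γ x
typeAt (Γ ▹ ty A) (here refl) = A

lookup≡typeAt : (Γ : Ctx V) (x : term ∈ V) → lookup Γ x ≡ ty (typeAt Γ x)
lookup≡typeAt (Γ ▹ ty A) (here refl) = refl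
lookup≡typeAt (Γ ▹ T)    (there x)   = cong wkClass (lookup≡typeAt Γ x)

-- Leaving out the validity of the context makes term typing invertible and keeps
-- the inductions below structural; ⊩⇒⊢ restores it.
infix 5 _⊩_∶_

data _⊩_∶_ {V} (Γ : Ctx V) : Term V → Ty → Set where
  var : ∀ {A} (x : term ∈ V) → typeAt Γ x ≡ A → Γ ⊩ var x ∶ A
  bot : Γ ⊩ bot ∶ Ω
  _⊃_ : ∀ {φ ψ} → Γ ⊩ φ ∶ Ω → Γ ⊩ ψ ∶ Ω → Γ ⊩ φ ⊃ ψ ∶ Ω
  _·_ : ∀ {A B M N} → Γ ⊩ M ∶ A ⇒ B → Γ ⊩ N ∶ A → Γ ⊩ M · N ∶ B
  ƛ   : ∀ {A B M} → Γ ▹ ty A ⊩ M ∶ B → Γ ⊩ ƛ A M ∶ A ⇒ B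

⊩-rename : {Γ : Ctx V} {Δ : Ctx W} {ρ : Ren V W} →
  (∀ x → typeAt Δ (ρ x) ≡ typeAt Γ x) →
  ∀ {M A} → Γ ⊩ M ∶ A → Δ ⊩ rename ρ M ∶ A
⊩-rename eq (var x eq′) = var _ (trans (eq x) eq′)
⊩-rename eq bot         = bot
⊩-rename eq (c ⊃ d)     = ⊩-rename eq c ⊃ ⊩-rename eq d
⊩-rename eq (c · d)     = ⊩-rename eq c · ⊩-rename eq d
⊩-rename eq (ƛ d)       = ƛ (⊩-rename (λ { (here refl) → refl ; (there x) → eq x }) d)

-- Strengthening: the premise of `⊢ƛₚ` yields a type for ψ only in weakened form, in the context
-- extended by φ.
⊩-rename⁻¹ : {Γ : Ctx V} {Δ : Ctx W} {ρ : Ren V W} →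
  (∀ x → typeAt Δ (ρ x) ≡ typeAt Γ x) →
  ∀ M {A} → Δ ⊩ rename ρ M ∶ A → Γ ⊩ M ∶ A
⊩-rename⁻¹ eq (var x) (var _ eq′) = var x (trans (sym (eq x)) eq′)
⊩-rename⁻¹ eq bot     bot         = bot
⊩-rename⁻¹ eq (φ ⊃ ψ) (c ⊃ d)     = ⊩-rename⁻¹ eq φ c ⊃ ⊩-rename⁻¹ eq ψ d
⊩-rename⁻¹ eq (M · N) (c · d)     = ⊩-rename⁻¹ eq M c · ⊩-rename⁻¹ eq N d
⊩-rename⁻¹ eq (ƛ A M) (ƛ d)       =
  ƛ (⊩-rename⁻¹ (λ { (here refl) → refl ; (there x) → eq x }) M d)

⊩-wk : {Γ : Ctx V} {T : Class V l} → ∀ {M A} → Γ ⊩ M ∶ A → Γ ▹ T ⊩ wk M ∶ A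
⊩-wk = ⊩-rename λ _ → refl

⊩-sub : {Γ : Ctx V} {Δ : Ctx W} {σ : Sub V W} →
  (∀ x → Δ ⊩ σ x ∶ typeAt Γ x) → ∀ {M A} → Γ ⊩ M ∶ A → Δ ⊩ sub σ M ∶ A
⊩-sub {Δ = Δ} s (var x eq) = subst (Δ ⊩ _ ∶_) eq (s x)
⊩-sub s bot        = bot
⊩-sub s (c ⊃ d)    = ⊩-sub s c ⊃ ⊩-sub s d
⊩-sub s (c · d)    = ⊩-sub s c · ⊩-sub s d
⊩-sub s (ƛ d)      =
  ƛ (⊩-sub (λ { (here refl) → var v₀ refl ; (there x) → ⊩-wk (s x) }) d)

⊩-⟶ : {Γ : Ctx V} {M M′ : Term V} {A : Ty} → Γ ⊩ M ∶ A → M ⟶ M′ → Γ ⊩ M′ ∶ A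
⊩-⟶ (c ⊃ d)   (⊃ˡ r) = ⊩-⟶ c r ⊃ d
⊩-⟶ (c ⊃ d)   (⊃ʳ r) = c ⊃ ⊩-⟶ d r
⊩-⟶ (ƛ c · d) β      = ⊩-sub (λ { (here refl) → d ; (there x) → var x refl }) c
⊩-⟶ (c · d)   (·ˡ r) = ⊩-⟶ c r · d

tyOf : Class V term → Ty
tyOf (ty A) = A

⊢⇒⊩ : {Γ : Ctx V} {M : Term V} {T : Class V term} → Γ ⊢ M ∶ T → Γ ⊩ M ∶ tyOf T
⊢⇒⊩ {Γ = Γ} (⊢var v x) = var x (sym (cong tyOf (lookup≡typeAt Γ x)))
⊢⇒⊩ (⊢bot v)   = bot
⊢⇒⊩ (⊢⊃ c d)   = ⊢⇒⊩ c ⊃ ⊢⇒⊩ d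
⊢⇒⊩ (⊢· c d)   = ⊢⇒⊩ c · ⊢⇒⊩ d
⊢⇒⊩ (⊢ƛ d)     = ƛ (⊢⇒⊩ d)

⊩⇒⊢ : {Γ : Ctx V} {M : Term V} {A : Ty} → Γ ⊢valid → Γ ⊩ M ∶ A → Γ ⊢ M ∶ ty A
⊩⇒⊢ {Γ = Γ} v (var x refl) = subst (Γ ⊢ var x ∶_) (lookup≡typeAt Γ x) (⊢var v x)
⊩⇒⊢ v bot     = ⊢bot v
⊩⇒⊢ v (c ⊃ d) = ⊢⊃ (⊩⇒⊢ v c) (⊩⇒⊢ v d)
⊩⇒⊢ v (c · d) = ⊢· (⊩⇒⊢ v c) (⊩⇒⊢ v d)
⊩⇒⊢ v (ƛ d)   = ⊢ƛ (⊩⇒⊢ (▹-ty v) d)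

-- Validity recast as a recursion on the context with ⊩ in place of ⊢, so that it can be projected
-- out of any derivation without mutual induction on typing; `valid-wf` leads back.
WfClass : Ctx V → Class V k → Set
WfClass Γ (ty A)       = ⊤
WfClass Γ (pf φ)       = Γ ⊩ φ ∶ Ω
WfClass Γ (M =[ A ] N) = Γ ⊩ M ∶ A × Γ ⊩ N ∶ A

Wf : Ctx V → Set
Wf ⟨⟩      = ⊤
Wf (Γ ▹ T) = Wf Γ × WfClass Γ T

wf-valid : {Γ : Ctx V} → Γ ⊢valid → Wf Γ
wf-⊢     : {Γ : Ctx V} {E : Expr V k} {T : Class V k} → Γ ⊢ E ∶ T → Wf Γ

wf-valid ⟨⟩         = _
wf-valid (▹-ty v)   = wf-valid v , _
wf-valid (▹-pf d)   = wf-⊢ d , ⊢⇒⊩ d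
wf-valid (▹-eq c d) = wf-⊢ c , ⊢⇒⊩ c , ⊢⇒⊩ d

wf-⊢ (⊢var v x)          = wf-valid v
wf-⊢ (⊢bot v)            = wf-valid v
wf-⊢ (⊢⊃ c d)            = wf-⊢ c
wf-⊢ (⊢· c d)            = wf-⊢ c
wf-⊢ (⊢ƛ d)              = proj₁ (wf-⊢ d)
wf-⊢ (⊢∙ c d)            = wf-⊢ c
wf-⊢ (⊢ƛₚ d)             = proj₁ (wf-⊢ d)
wf-⊢ (⊢convₚ d _ _)      = wf-⊢ d
wf-⊢ (⊢ref d)            = wf-⊢ d
wf-⊢ (⊢⊃* c d)           = wf-⊢ c
wf-⊢ (⊢univ c d)         = wf-⊢ c
wf-⊢ (⊢⁺ d)              = wf-⊢ d
wf-⊢ (⊢⁻ d)              = wf-⊢ d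
wf-⊢ (⊢ƛ* _ d _)         = wf-⊢ d
wf-⊢ (⊢·* d _ _ _)       = wf-⊢ d
wf-⊢ (⊢conv* d _ _ _ _)  = wf-⊢ d

valid-wf : {Γ : Ctx V} → Wf Γ → Γ ⊢valid
valid-wf {Γ = ⟨⟩}              w           = ⟨⟩
valid-wf {Γ = Γ ▹ ty A}        (w , _)     = ▹-ty (valid-wf w)
valid-wf {Γ = Γ ▹ pf φ}        (w , d)     = ▹-pf (⊩⇒⊢ (valid-wf w) d)
valid-wf {Γ = Γ ▹ (M =[ A ] N)} (w , c , d) =
  ▹-eq (⊩⇒⊢ (valid-wf w) c) (⊩⇒⊢ (valid-wf w) d)

valid-⊢ : {Γ : Ctx V} {E : Expr V k} {T : Class V k} → Γ ⊢ E ∶ T → Γ ⊢valid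
valid-⊢ d = valid-wf (wf-⊢ d)

wfClass-wk : {Γ : Ctx V} {S : Class V l} (T : Class V k) →
  WfClass Γ T → WfClass (Γ ▹ S) (wkClass T)
wfClass-wk (ty A)       _       = _
wfClass-wk (pf φ)       d       = ⊩-wk d
wfClass-wk (M =[ A ] N) (c , d) = ⊩-wk c , ⊩-wk d

wfClass-lookup : (Γ : Ctx V) → Wf Γ → (x : k ∈ V) → WfClass Γ (lookup Γ x)
wfClass-lookup (Γ ▹ T) (w , d) (here refl) = wfClass-wk T d
wfClass-lookup (Γ ▹ T) (w , d) (there x)   = wfClass-wk (lookup Γ x) (wfClass-lookup Γ w x)

wfClass-⊢ : {Γ : Ctx V} {E : Expr V k} {T : Class V k} → Γ ⊢ E ∶ T → WfClass Γ T
wfClass-⊢ {Γ = Γ} (⊢var v x) = wfClass-lookup Γ (wf-valid v) x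
wfClass-⊢ (⊢bot v)           = _
wfClass-⊢ (⊢⊃ c d)           = _
wfClass-⊢ (⊢· c d)           = _
wfClass-⊢ (⊢ƛ d)             = _
wfClass-⊢ (⊢∙ c d)           with wfClass-⊢ c
... | _ ⊃ e = e
wfClass-⊢ (⊢ƛₚ {ψ = ψ} d)    =
  proj₂ (wf-⊢ d) ⊃ ⊩-rename⁻¹ (λ _ → refl) ψ (wfClass-⊢ d)
wfClass-⊢ (⊢convₚ _ d _)     = ⊢⇒⊩ d
wfClass-⊢ (⊢ref d)           = ⊢⇒⊩ d , ⊢⇒⊩ d
wfClass-⊢ (⊢⊃* c d)          with wfClass-⊢ c | wfClass-⊢ d
... | c₁ , c₂ | d₁ , d₂ = c₁ ⊃ d₁ , c₂ ⊃ d₂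
wfClass-⊢ (⊢univ c d)        with wfClass-⊢ c
... | e₁ ⊃ e₂ = e₁ , e₂
wfClass-⊢ (⊢⁺ d)             with wfClass-⊢ d
... | d₁ , d₂ = d₁ ⊃ d₂
wfClass-⊢ (⊢⁻ d)             with wfClass-⊢ d
... | d₁ , d₂ = d₂ ⊃ d₁
wfClass-⊢ (⊢ƛ* _ c d)        = ⊢⇒⊩ c , ⊢⇒⊩ d
wfClass-⊢ (⊢·* c _ d d′)     with wfClass-⊢ c
... | c₁ , c₂ = c₁ · ⊢⇒⊩ d , c₂ · ⊢⇒⊩ d′
wfClass-⊢ (⊢conv* _ c d _ _) = ⊢⇒⊩ c , ⊢⇒⊩ d

-- Typed substitutions

subClass : Sub V W → Class V k → Class W k
subClass σ (ty A)       = ty A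
subClass σ (pf φ)       = pf (sub σ φ)
subClass σ (M =[ A ] N) = sub σ M =[ A ] sub σ N

subClass-wk : (σ : Sub V W) (T : Class V k) →
  subClass (liftSub {l = l} σ) (wkClass T) ≡ wkClass (subClass σ T)
subClass-wk σ (ty A)       = refl
subClass-wk σ (pf φ)       = cong pf (wk-sub σ φ)
subClass-wk σ (M =[ A ] N) = cong₂ _=[ A ]_ (wk-sub σ M) (wk-sub σ N)

subClass-◂ : (σ : Sub V W) (F : Expr W l) (T : Class V k) →
  subClass (σ ◂ F) (wkClass T) ≡ subClass σ T
subClass-◂ σ F (ty A)       = refl
subClass-◂ σ F (pf φ)       = cong pf (sub-◂-wk σ F φ)
subClass-◂ σ F (M =[ A ] N) = cong₂ _=[ A ]_ (sub-◂-wk σ F M) (sub-◂-wk σ F N)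

subClass-id : (T : Class V k) → subClass var T ≡ T
subClass-id (ty A)       = refl
subClass-id (pf φ)       = cong pf (sub-id φ)
subClass-id (M =[ A ] N) = cong₂ _=[ A ]_ (sub-id M) (sub-id N)

wkClass≡sub : (T : Class V k) → wkClass {l = l} T ≡ subClass (λ x → var (there x)) T
wkClass≡sub (ty A)       = refl
wkClass≡sub (pf φ)       = cong pf (rename≡sub there φ)
wkClass≡sub (M =[ A ] N) = cong₂ _=[ A ]_ (rename≡sub there M) (rename≡sub there N)

⊢-≡ : {Γ : Ctx V} {E E′ : Expr V k} {T T′ : Class V k} →
  E ≡ E′ → T ≡ T′ → Γ ⊢ E ∶ T → Γ ⊢ E′ ∶ T′
⊢-≡ refl refl d = d

valid³ : {Γ : Ctx V} {A : Ty} → Γ ⊢valid → Γ ▹³ A ⊢valid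
valid³ v = ▹-eq (⊢var (▹-ty (▹-ty v)) v₁) (⊢var (▹-ty (▹-ty v)) v₀)

TypedSub : Ctx V → Ctx W → Sub V W → Set
TypedSub {V} Γ Δ σ = ∀ {k} (x : k ∈ V) → Δ ⊢ σ x ∶ subClass σ (lookup Γ x)

typedSub-⊩ : {Γ : Ctx V} {Δ : Ctx W} {σ : Sub V W} → TypedSub Γ Δ σ →
  (x : term ∈ V) → Δ ⊩ σ x ∶ typeAt Γ x
typedSub-⊩ {Γ = Γ} {Δ} {σ} s x =
  subst (λ T → Δ ⊩ σ x ∶ tyOf (subClass σ T)) (lookup≡typeAt Γ x) (⊢⇒⊩ (s x))

-- Instantiated first with renamings, then with all typed substitutions.
module Substitution
  (Good : ∀ {V W} → Ctx V → Ctx W → Sub V W → Set)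
  (lift : ∀ {V W l} {Γ : Ctx V} {Δ : Ctx W} {σ : Sub V W} {T : Class V l} →
    Good Γ Δ σ → Δ ▹ subClass σ T ⊢valid →
    Good (Γ ▹ T) (Δ ▹ subClass σ T) (liftSub σ))
  (typed : ∀ {V W} {Γ : Ctx V} {Δ : Ctx W} {σ : Sub V W} →
    Good Γ Δ σ → Δ ⊢valid → TypedSub Γ Δ σ) where

  ⊢sub′ : {Γ : Ctx V} {Δ : Ctx W} {σ : Sub V W} {E : Expr V k} {T : Class V k} →
    Γ ⊢ E ∶ T → Good Γ Δ σ → Δ ⊢valid → Δ ⊢ sub σ E ∶ subClass σ T
  ⊢sub′ (⊢var _ x)      g v = typed g v x
  ⊢sub′ (⊢bot _)        g v = ⊢bot v
  ⊢sub′ (⊢⊃ c d)        g v = ⊢⊃ (⊢sub′ c g v) (⊢sub′ d g v)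
  ⊢sub′ (⊢· c d)        g v = ⊢· (⊢sub′ c g v) (⊢sub′ d g v)
  ⊢sub′ (⊢ƛ d)          g v = ⊢ƛ (⊢sub′ d (lift g (▹-ty v)) (▹-ty v))
  ⊢sub′ (⊢∙ c d)        g v = ⊢∙ (⊢sub′ c g v) (⊢sub′ d g v)
  ⊢sub′ {Γ = Γ} {σ = σ} (⊢ƛₚ {ψ = ψ} d) g v =
    ⊢ƛₚ (⊢-≡ refl (cong pf (wk-sub σ ψ)) (⊢sub′ d (lift g v′) v′))
    -- The typing of φ is extracted from d by `wf-⊢` and is no visible subderivation, so a recursive
    -- call on it would not be structural. The separate induction `⊩-sub` provides it.
    where v′ = ▹-pf (⊩⇒⊢ v (⊩-sub (typedSub-⊩ {Γ = Γ} (typed g v)) (proj₂ (wf-⊢ d))))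
  ⊢sub′ {σ = σ} (⊢convₚ c d eq) g v = ⊢convₚ (⊢sub′ c g v) (⊢sub′ d g v) (sub-≃ σ eq)
  ⊢sub′ (⊢ref d)        g v = ⊢ref (⊢sub′ d g v)
  ⊢sub′ (⊢⊃* c d)       g v = ⊢⊃* (⊢sub′ c g v) (⊢sub′ d g v)
  ⊢sub′ (⊢univ c d)     g v = ⊢univ (⊢sub′ c g v) (⊢sub′ d g v)
  ⊢sub′ (⊢⁺ d)          g v = ⊢⁺ (⊢sub′ d g v)
  ⊢sub′ (⊢⁻ d)          g v = ⊢⁻ (⊢sub′ d g v)
  ⊢sub′ {σ = σ} (⊢ƛ* {A} {B} {M} {N} d c c′) g v = ⊢ƛ*
    (⊢-≡ refl (cong₂ (λ M N → M · var v₂ =[ B ] N · var v₁) (wk³-sub σ M) (wk³-sub σ N))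
      (⊢sub′ d (lift (lift (lift g (▹-ty v)) (▹-ty (▹-ty v))) (valid³ v)) (valid³ v)))
    (⊢sub′ c g v) (⊢sub′ c′ g v)
  ⊢sub′ (⊢·* c d e e′)  g v = ⊢·* (⊢sub′ c g v) (⊢sub′ d g v) (⊢sub′ e g v) (⊢sub′ e′ g v)
  ⊢sub′ {σ = σ} (⊢conv* c d d′ eq eq′) g v =
    ⊢conv* (⊢sub′ c g v) (⊢sub′ d g v) (⊢sub′ d′ g v) (sub-≃ σ eq) (sub-≃ σ eq′)

module _ where
  private
    data TypedRen {V W} (Γ : Ctx V) (Δ : Ctx W) (σ : Sub V W) : Set where
      typedRen : (ρ : Ren V W) → var ∘ ρ ≗ σ →
        (∀ {k} (x : k ∈ V) → lookup Δ (ρ x) ≡ subClass σ (lookup Γ x)) → TypedRen Γ Δ σ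

    lift : ∀ {V W l} {Γ : Ctx V} {Δ : Ctx W} {σ : Sub V W} {T : Class V l} →
      TypedRen Γ Δ σ → Δ ▹ subClass σ T ⊢valid →
      TypedRen (Γ ▹ T) (Δ ▹ subClass σ T) (liftSub σ)
    lift {Γ = Γ} {σ = σ} {T} (typedRen ρ eq eq′) v = typedRen (liftRen ρ) (lift-ren eq)
      λ { (here refl) → sym (subClass-wk σ T)
        ; (there x)   → trans (cong wkClass (eq′ x)) (sym (subClass-wk σ (lookup Γ x))) }

    typed : ∀ {V W} {Γ : Ctx V} {Δ : Ctx W} {σ : Sub V W} →
      TypedRen Γ Δ σ → Δ ⊢valid → TypedSub Γ Δ σ
    typed (typedRen ρ eq eq′) v x = ⊢-≡ (eq x) (eq′ x) (⊢var v (ρ x))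

  ⊢wk : {Γ : Ctx V} {S : Class V l} {E : Expr V k} {T : Class V k} →
    Γ ⊢ E ∶ T → Γ ▹ S ⊢valid → Γ ▹ S ⊢ wk E ∶ wkClass T
  ⊢wk {Γ = Γ} {E = E} {T} d v =
    ⊢-≡ (sym (rename≡sub there E)) (sym (wkClass≡sub T))
      (Substitution.⊢sub′ TypedRen lift typed d
        (typedRen there (λ _ → refl) λ x → wkClass≡sub (lookup Γ x)) v)

module _ where
  private
    lift : ∀ {V W l} {Γ : Ctx V} {Δ : Ctx W} {σ : Sub V W} {T : Class V l} →
      TypedSub Γ Δ σ → Δ ▹ subClass σ T ⊢valid →
      TypedSub (Γ ▹ T) (Δ ▹ subClass σ T) (liftSub σ)
    lift {Γ = Γ} {σ = σ} {T} s v (here refl) = ⊢-≡ refl (sym (subClass-wk σ T)) (⊢var v v₀)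
    lift {Γ = Γ} {σ = σ} {T} s v (there x)   =
      ⊢-≡ refl (sym (subClass-wk σ (lookup Γ x))) (⊢wk (s x) v)

  ⊢sub : {Γ : Ctx V} {Δ : Ctx W} {σ : Sub V W} {E : Expr V k} {T : Class V k} →
    Γ ⊢ E ∶ T → TypedSub Γ Δ σ → Δ ⊢valid → Δ ⊢ sub σ E ∶ subClass σ T
  ⊢sub = Substitution.⊢sub′ (λ Γ Δ σ → TypedSub Γ Δ σ)
    (λ {_} {_} {_} {Γ} {Δ} {σ} {T} → lift {Γ = Γ} {Δ} {σ} {T}) (λ {_} {_} {Γ} {Δ} {σ} s _ → s)

typedSub-var : {Γ : Ctx V} → Γ ⊢valid → TypedSub Γ Γ var
typedSub-var {Γ = Γ} v x = ⊢-≡ refl (sym (subClass-id (lookup Γ x))) (⊢var v x)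

typedSub-◂ : {Γ : Ctx V} {Δ : Ctx W} {σ : Sub V W} {F : Expr W l} {T : Class V l} →
  TypedSub Γ Δ σ → Δ ⊢ F ∶ subClass σ T → TypedSub (Γ ▹ T) Δ (σ ◂ F)
typedSub-◂ {σ = σ} {F} {T} s d (here refl) = ⊢-≡ refl (sym (subClass-◂ σ F T)) d
typedSub-◂ {Γ = Γ} {σ = σ} {F} s d (there x) =
  ⊢-≡ refl (sym (subClass-◂ σ F (lookup Γ x))) (s x)

⊢⟦⟧ : {Γ : Ctx V} {Δ : Ctx W} {τ : PathSub V W} {ρ σ : Sub V W} {L : Term V} {A : Ty} →
  Γ ⊩ L ∶ A → Δ ⊢valid →
  (∀ x → Δ ⊩ ρ x ∶ typeAt Γ x) → (∀ x → Δ ⊩ σ x ∶ typeAt Γ x) →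
  (∀ x → Δ ⊢ τ x ∶ (ρ x =[ typeAt Γ x ] σ x)) →
  Δ ⊢ L ⟦ τ ∶ ρ ∼ σ ⟧ ∶ (sub ρ L =[ A ] sub σ L)
⊢⟦⟧ (var x refl) v r s t = t x
⊢⟦⟧ bot          v r s t = ⊢ref (⊢bot v)
⊢⟦⟧ (c ⊃ d)      v r s t = ⊢⊃* (⊢⟦⟧ c v r s t) (⊢⟦⟧ d v r s t)
⊢⟦⟧ (c · d)      v r s t =
  ⊢·* (⊢⟦⟧ c v r s t) (⊢⟦⟧ d v r s t) (⊩⇒⊢ v (⊩-sub r d)) (⊩⇒⊢ v (⊩-sub s d))
-- The induction hypothesis relates the two instances of the body, whereas `⊢ƛ*` asks for the
-- abstractions applied to v₂ and v₁. One backward β-step on each side closes the gap.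
⊢⟦⟧ {ρ = ρ} {σ} {L = ƛ A L} (ƛ d) v r s t = ⊢ƛ*
  (⊢conv* (⊢⟦⟧ d v³ (λ { (here refl) → var v₂ refl ; (there x) → ⊩-rename (λ _ → refl) (r x) })
                    (λ { (here refl) → var v₁ refl ; (there x) → ⊩-rename (λ _ → refl) (s x) })
                    λ { (here refl) → ⊢var v³ v₀
                      ; (there x) → ⊢wk³ (t x) })
    (⊩⇒⊢ v³ (⊩-rename (λ _ → refl) (⊩-sub r (ƛ d)) · var v₂ refl))
    (⊩⇒⊢ v³ (⊩-rename (λ _ → refl) (⊩-sub s (ƛ d)) · var v₁ refl))
    (bwd (ƛ-β _ ρ A L (var v₂)) ◅ nil) (bwd (ƛ-β _ σ A L (var v₁)) ◅ nil))
  (⊩⇒⊢ v (⊩-sub r (ƛ d))) (⊩⇒⊢ v (⊩-sub s (ƛ d)))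
  where
  v³ = valid³ v
  ⊢wk³ : ∀ {P M N B} → _ ⊢ P ∶ (M =[ B ] N) → _ ⊢ wk³ P ∶ (wk³ M =[ B ] wk³ N)
  ⊢wk³ {P} {M} {N} {B} d = ⊢-≡ (wk³≡ P) (cong₂ _=[ B ]_ (wk³≡ M) (wk³≡ N))
    (⊢wk (⊢wk (⊢wk d (▹-ty v)) (▹-ty (▹-ty v))) v³)

-- Inversion of typing and subject reduction

gen-ref : {Γ : Ctx V} {M M₁ M₂ : Term V} {A : Ty} → Γ ⊢ ref M ∶ (M₁ =[ A ] M₂) →
  Γ ⊩ M ∶ A × M ≃ M₁ × M ≃ M₂
gen-ref (⊢ref d) = ⊢⇒⊩ d , nil , nil
gen-ref (⊢conv* d _ _ eq eq′) with gen-ref d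
... | c , eq₁ , eq₂ = c , eq₁ ◅◅ eq , eq₂ ◅◅ eq′

gen-univ : {Γ : Ctx V} {φ ψ M₁ M₂ : Term V} {δ ε : Proof V} {A : Ty} →
  Γ ⊢ univ φ ψ δ ε ∶ (M₁ =[ A ] M₂) →
  A ≡ Ω × Γ ⊢ δ ∶ pf (φ ⊃ ψ) × Γ ⊢ ε ∶ pf (ψ ⊃ φ) × φ ≃ M₁ × ψ ≃ M₂
gen-univ (⊢univ c d) = refl , c , d , nil , nil
gen-univ (⊢conv* d _ _ eq eq′) with gen-univ d
... | refl , c₁ , c₂ , eq₁ , eq₂ = refl , c₁ , c₂ , eq₁ ◅◅ eq , eq₂ ◅◅ eq′

gen-ƛ* : {Γ : Ctx V} {P : Path _} {M₁ M₂ : Term V} {A A′ B : Ty} →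
  Γ ⊢ ƛ* A′ P ∶ (M₁ =[ A ⇒ B ] M₂) →
  A′ ≡ A × Γ ▹³ A ⊢ P ∶ (wk³ M₁ · var v₂ =[ B ] wk³ M₂ · var v₁)
gen-ƛ* (⊢ƛ* d _ _) = refl , d
gen-ƛ* (⊢conv* d c c′ eq eq′) with gen-ƛ* d
... | refl , e = refl , ⊢conv* e
  (⊩⇒⊢ v (⊩-rename (λ _ → refl) (⊢⇒⊩ c) · var v₂ refl))
  (⊩⇒⊢ v (⊩-rename (λ _ → refl) (⊢⇒⊩ c′) · var v₁ refl))
  (·-≃ˡ (rename-≃ _ eq)) (·-≃ˡ (rename-≃ _ eq′))
  where v = valid-⊢ e

-- The identity is a typed substitution between the two contexts, since the last variable can be
-- converted.
⊢-ctx-≃ : {Γ : Ctx V} {φ φ′ : Term V} {E : Expr (proof ∷ V) k} {T : Class (proof ∷ V) k} →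
  Γ ▹ pf φ′ ⊢ E ∶ T → Γ ⊩ φ ∶ Ω → φ ≃ φ′ → Γ ▹ pf φ ⊢ E ∶ T
⊢-ctx-≃ {Γ = Γ} {φ} {φ′} {E} {T} d c eq =
  ⊢-≡ (sub-id E) (subClass-id T) (⊢sub d s v)
  where
  w = wf-⊢ d
  v = valid-wf {Γ = Γ ▹ pf φ} (proj₁ w , c)
  s : TypedSub (Γ ▹ pf φ′) (Γ ▹ pf φ) var
  s (here refl) = ⊢-≡ refl (sym (cong pf (sub-id (wk φ′))))
    (⊢convₚ (⊢var v v₀) (⊩⇒⊢ v (⊩-wk (proj₂ w))) (rename-≃ there eq))
  s (there x)   = ⊢-≡ refl (sym (subClass-id (wkClass (lookup Γ x)))) (⊢var v (there x))

-- The type is a proposition χ merely convertible to φ ⊃ ψ, because the intermediate propositions in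
-- a chain of `⊢convₚ` need not be implications.
gen-ƛₚ : {Γ : Ctx V} {φ φ′ ψ χ : Term V} {δ : Proof _} →
  Γ ⊢ ƛₚ φ′ δ ∶ pf χ → χ ≃ φ ⊃ ψ → Γ ⊩ φ ∶ Ω → Γ ⊩ ψ ∶ Ω →
  φ′ ≃ φ × Γ ▹ pf φ ⊢ δ ∶ pf (wk ψ)
gen-ƛₚ (⊢ƛₚ d) eq c c′ with ⊃-injective eq
... | eq₁ , eq₂ = eq₁ ,
  ⊢convₚ e (⊩⇒⊢ (valid-⊢ e) (⊩-wk c′)) (rename-≃ there eq₂)
  where e = ⊢-ctx-≃ d c (symmetric _ eq₁)
gen-ƛₚ (⊢convₚ d _ eq′) eq c c′ = gen-ƛₚ d (eq′ ◅◅ eq) c c′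

⊢id : {Γ : Ctx V} {φ : Term V} → Γ ⊢valid → Γ ⊩ φ ∶ Ω → Γ ⊢ ƛₚ φ (var v₀) ∶ pf (φ ⊃ φ)
⊢id v c = ⊢ƛₚ (⊢var (▹-pf (⊩⇒⊢ v c)) v₀)

⊢ƛₚƛₚ : {Γ : Ctx V} {φ ψ χ : Term V} {δ : Proof _} → Γ ⊢valid → Γ ⊩ φ ∶ Ω → Γ ⊩ ψ ∶ Ω →
  (Γ ▹ pf φ ▹ pf (wk ψ) ⊢valid → Γ ▹ pf φ ▹ pf (wk ψ) ⊢ δ ∶ pf (wk (wk χ))) →
  Γ ⊢ ƛₚ φ (ƛₚ (wk ψ) δ) ∶ pf (φ ⊃ ψ ⊃ χ)
⊢ƛₚƛₚ v c d f = ⊢ƛₚ (⊢ƛₚ (f (▹-pf (⊩⇒⊢ (▹-pf (⊩⇒⊢ v c)) (⊩-wk d)))))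

⊢wk² : {Γ : Ctx V} {φ χ : Term V} {ψ′ : Term _} {δ : Proof V} → Γ ⊢ δ ∶ pf χ →
  Γ ▹ pf φ ▹ pf ψ′ ⊢valid → Γ ▹ pf φ ▹ pf ψ′ ⊢ wk (wk δ) ∶ pf (wk (wk χ))
⊢wk² d v = ⊢wk (⊢wk d (valid-wf (proj₁ (wf-valid v)))) v

⊃-≃ : {φ φ′ ψ ψ′ : Term V} → φ ≃ φ′ → ψ ≃ ψ′ → φ ⊃ ψ ≃ φ′ ⊃ ψ′
⊃-≃ eq eq′ = Eq.gmap (_⊃ _) ⊃ˡ eq ◅◅ Eq.gmap (_ ⊃_) ⊃ʳ eq′

-- This and the next two lemmas type the components of the contracta of `ref⊃*univ`, `univ⊃*ref` and
-- `univ⊃*univ`: composition after, before, and on both sides.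
⊢postcompose : {Γ : Ctx V} {φ ψ χ : Term V} {δ : Proof V} →
  Γ ⊢ δ ∶ pf (ψ ⊃ χ) → Γ ⊩ φ ∶ Ω →
  Γ ⊢ ƛₚ (φ ⊃ ψ) (ƛₚ (wk φ) (wk (wk δ) ∙ (var v₁ ∙ var v₀))) ∶ pf ((φ ⊃ ψ) ⊃ φ ⊃ χ)
⊢postcompose d c with wfClass-⊢ d
... | c′ ⊃ _ = ⊢ƛₚƛₚ (valid-⊢ d) (c ⊃ c′) c λ v →
  ⊢∙ (⊢wk² d v) (⊢∙ (⊢var v v₁) (⊢var v v₀))

⊢precompose : {Γ : Ctx V} {φ ψ χ : Term V} {ε : Proof V} →
  Γ ⊢ ε ∶ pf (ψ ⊃ φ) → Γ ⊩ χ ∶ Ω →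
  Γ ⊢ ƛₚ (φ ⊃ χ) (ƛₚ (wk ψ) (var v₁ ∙ (wk (wk ε) ∙ var v₀))) ∶ pf ((φ ⊃ χ) ⊃ ψ ⊃ χ)
⊢precompose d c with wfClass-⊢ d
... | c₁ ⊃ c₂ = ⊢ƛₚƛₚ (valid-⊢ d) (c₂ ⊃ c) c₁ λ v →
  ⊢∙ (⊢var v v₁) (⊢∙ (⊢wk² d v) (⊢var v v₀))

⊢bicompose : {Γ : Ctx V} {φ ψ φ′ ψ′ : Term V} {δ ε : Proof V} →
  Γ ⊢ δ ∶ pf (φ′ ⊃ ψ′) → Γ ⊢ ε ∶ pf (ψ ⊃ φ) →
  Γ ⊢ ƛₚ (φ ⊃ φ′) (ƛₚ (wk ψ) (wk (wk δ) ∙ (var v₁ ∙ (wk (wk ε) ∙ var v₀))))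
    ∶ pf ((φ ⊃ φ′) ⊃ ψ ⊃ ψ′)
⊢bicompose d e with wfClass-⊢ d | wfClass-⊢ e
... | c₁ ⊃ _ | c₂ ⊃ c₃ = ⊢ƛₚƛₚ (valid-⊢ d) (c₃ ⊃ c₁) c₂ λ v →
  ⊢∙ (⊢wk² d v) (⊢∙ (⊢var v v₁) (⊢∙ (⊢wk² e v) (⊢var v v₀)))

⊢conv*′ : {Γ : Ctx V} {M M′ N N′ : Term V} {A : Ty} {P : Path V} →
  Γ ⊢ P ∶ (M =[ A ] N) → WfClass Γ (M′ =[ A ] N′) → M ≃ M′ → N ≃ N′ →
  Γ ⊢ P ∶ (M′ =[ A ] N′)
⊢conv*′ d (c , c′) = ⊢conv* d (⊩⇒⊢ (valid-⊢ d) c) (⊩⇒⊢ (valid-⊢ d) c′)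

-- Inversion reveals endpoints that agree with the declared ones only up to ≃. Where they differ,
-- the contractum is typed at its own endpoints and then converted back.
⊢-⟶* : {Γ : Ctx V} {P Q : Path V} {T : Class V path} → Γ ⊢ P ∶ T → P ⟶ Q → Γ ⊢ Q ∶ T
⊢-⟶* (⊢conv* d c c′ eq eq′) r = ⊢conv* (⊢-⟶* d r) c c′ eq eq′
⊢-⟶* (⊢⊃* c d) (⊃*ˡ r) = ⊢⊃* (⊢-⟶* c r) d
⊢-⟶* (⊢⊃* c d) (⊃*ʳ r) = ⊢⊃* c (⊢-⟶* d r)
⊢-⟶* (⊢⊃* c d) ref⊃*ref with gen-ref c | gen-ref d
... | e , eq₁ , eq₂ | e′ , eq₃ , eq₄ = ⊢conv*′ (⊢ref (⊩⇒⊢ (valid-⊢ c) (e ⊃ e′)))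
  (wfClass-⊢ (⊢⊃* c d)) (⊃-≃ eq₁ eq₃) (⊃-≃ eq₂ eq₄)
⊢-⟶* (⊢⊃* c d) ref⊃*univ with gen-ref c | gen-univ d
... | e , eq₁ , eq₂ | _ , d₁ , d₂ , eq₃ , eq₄ = ⊢conv*′
  (⊢univ (⊢postcompose d₁ e) (⊢postcompose d₂ e))
  (wfClass-⊢ (⊢⊃* c d)) (⊃-≃ eq₁ eq₃) (⊃-≃ eq₂ eq₄)
⊢-⟶* (⊢⊃* c d) univ⊃*ref with gen-univ c | gen-ref d
... | _ , c₁ , c₂ , eq₁ , eq₂ | e , eq₃ , eq₄ = ⊢conv*′
  (⊢univ (⊢precompose c₂ e) (⊢precompose c₁ e))
  (wfClass-⊢ (⊢⊃* c d)) (⊃-≃ eq₁ eq₃) (⊃-≃ eq₂ eq₄)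
⊢-⟶* (⊢⊃* c d) univ⊃*univ with gen-univ c | gen-univ d
... | _ , c₁ , c₂ , eq₁ , eq₂ | _ , d₁ , d₂ , eq₃ , eq₄ = ⊢conv*′
  (⊢univ (⊢bicompose d₁ c₂) (⊢bicompose d₂ c₁))
  (wfClass-⊢ (⊢⊃* c d)) (⊃-≃ eq₁ eq₃) (⊃-≃ eq₂ eq₄)
⊢-⟶* (⊢·* c d e e′) (·*ˡ r) = ⊢·* (⊢-⟶* c r) d e e′
-- Both endpoints of `ref M′` are M′, so r backwards leads to M and from there to the declared
-- endpoints.
⊢-⟶* (⊢·* c d e e′) (ref·* r) with gen-ref c
... | f , eq , eq′ = ⊢·*
  (⊢conv*′ (⊢ref (⊩⇒⊢ (valid-⊢ c) (⊩-⟶ f r))) (wfClass-⊢ c) (bwd r ◅ eq) (bwd r ◅ eq′)) d e e′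
⊢-⟶* (⊢·* {B = B} {M = M} {M′} {N} {N′} {Q = Q} c d e e′) (β* {P = P}) with gen-ƛ* c
... | refl , f = ⊢-≡ refl (cong₂ (λ M M′ → M · N =[ B ] M′ · N′) (eq M) (eq M′))
  (⊢sub f (typedSub-◂ (typedSub-◂ (typedSub-◂ (typedSub-var (valid-⊢ c)) e) e′) d) (valid-⊢ c))
  where
  eq : ∀ M → sub (var ◂ N ◂ N′ ◂ Q) (wk³ M) ≡ M
  eq M = trans (sub-rename _ _ M) (sub-id M)
⊢-⟶* (⊢·* c d e e′) refƛ with gen-ref c
... | ƛ f , eq , eq′ = ⊢conv*′
  (⊢⟦⟧ f v (λ { (here refl) → ⊢⇒⊩ e ; (there x) → var x refl })
           (λ { (here refl) → ⊢⇒⊩ e′ ; (there x) → var x refl })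
           (λ { (here refl) → d ; (there x) → ⊢ref (⊩⇒⊢ v (var x refl)) }))
  (wfClass-⊢ (⊢·* c d e e′)) (bwd β ◅ ·-≃ˡ eq) (bwd β ◅ ·-≃ˡ eq′)
  where v = valid-⊢ c

⊢-⟶ₚ : {Γ : Ctx V} {δ ε : Proof V} {T : Class V proof} → Γ ⊢ δ ∶ T → δ ⟶ ε → Γ ⊢ ε ∶ T
⊢-⟶ₚ (⊢convₚ d c eq) r = ⊢convₚ (⊢-⟶ₚ d r) c eq
⊢-⟶ₚ (⊢∙ c d) (∙ˡ r)   = ⊢∙ (⊢-⟶ₚ c r) d
⊢-⟶ₚ {Γ = Γ} (⊢∙ {ψ = ψ} {ε = ε} c d) βₚ with wfClass-⊢ c
... | e ⊃ e′ = ⊢-≡ refl (cong pf (trans (sub-◂-wk var ε ψ) (sub-id ψ)))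
  (⊢sub (proj₂ (gen-ƛₚ c nil e e′))
    (typedSub-◂ (typedSub-var v) (⊢-≡ refl (sym (subClass-id _)) d)) v)
  where v = valid-⊢ c
⊢-⟶ₚ (⊢⁺ d) (⁺-cong r) = ⊢⁺ (⊢-⟶* d r)
⊢-⟶ₚ (⊢⁺ d) ref⁺ with gen-ref d
... | c , eq , eq′ = ⊢convₚ (⊢id v c) (⊩⇒⊢ v (wfClass-⊢ (⊢⁺ d))) (⊃-≃ eq eq′)
  where v = valid-⊢ d
⊢-⟶ₚ (⊢⁺ d) univ⁺ with gen-univ d
... | _ , c , _ , eq , eq′ = ⊢convₚ c (⊩⇒⊢ (valid-⊢ d) (wfClass-⊢ (⊢⁺ d))) (⊃-≃ eq eq′)
⊢-⟶ₚ (⊢⁻ d) (⁻-cong r) = ⊢⁻ (⊢-⟶* d r)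
⊢-⟶ₚ (⊢⁻ d) ref⁻ with gen-ref d
... | c , eq , eq′ = ⊢convₚ (⊢id v c) (⊩⇒⊢ v (wfClass-⊢ (⊢⁻ d))) (⊃-≃ eq′ eq)
  where v = valid-⊢ d
⊢-⟶ₚ (⊢⁻ d) univ⁻ with gen-univ d
... | _ , _ , c , eq , eq′ = ⊢convₚ c (⊩⇒⊢ (valid-⊢ d) (wfClass-⊢ (⊢⁻ d))) (⊃-≃ eq′ eq)

⊢-↠* : {Γ : Ctx V} {P Q : Path V} {T : Class V path} → Γ ⊢ P ∶ T → P ↠ Q → Γ ⊢ Q ∶ T
⊢-↠* d nil      = d
⊢-↠* d (r ◅ rs) = ⊢-↠* (⊢-⟶* d r) rs

⊢-↠ₚ : {Γ : Ctx V} {δ ε : Proof V} {T : Class V proof} → Γ ⊢ δ ∶ T → δ ↠ ε → Γ ⊢ ε ∶ T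
⊢-↠ₚ d nil      = d
⊢-↠ₚ d (r ◅ rs) = ⊢-↠ₚ (⊢-⟶ₚ d r) rs

-- Computability of the operations on proofs and on paths at Ω

CΩ-⁺ : {θ θ′ : NfProp} {P : Path V} → CΩ θ θ′ P → Cₚ (θ ⊃ⁿ θ′) (P ⁺)
CΩ-⁺ {θ = θ} {θ′} (neutral rs n) =
  Cₚ-expand (θ ⊃ⁿ θ′) (gmap _⁺ ⁺-cong rs) (Cₚ-neutral (θ ⊃ⁿ θ′) (n ⁺))
CΩ-⁺ {θ = θ} (ref rs refl) =
  Cₚ-expand (θ ⊃ⁿ θ) (gmap _⁺ ⁺-cong rs ◅◅ ref⁺ ◅ nil) (Cₚ-ƛ θ θ λ _ _ c → c)
CΩ-⁺ {θ = θ} {θ′} (univ rs c d) =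
  Cₚ-expand (θ ⊃ⁿ θ′) (gmap _⁺ ⁺-cong rs ◅◅ univ⁺ ◅ nil) c

CΩ-⁻ : {θ θ′ : NfProp} {P : Path V} → CΩ θ θ′ P → Cₚ (θ′ ⊃ⁿ θ) (P ⁻)
CΩ-⁻ {θ = θ} {θ′} (neutral rs n) =
  Cₚ-expand (θ′ ⊃ⁿ θ) (gmap _⁻ ⁻-cong rs) (Cₚ-neutral (θ′ ⊃ⁿ θ) (n ⁻))
CΩ-⁻ {θ = θ} (ref rs refl) =
  Cₚ-expand (θ ⊃ⁿ θ) (gmap _⁻ ⁻-cong rs ◅◅ ref⁻ ◅ nil) (Cₚ-ƛ θ θ λ _ _ c → c)
CΩ-⁻ {θ = θ} {θ′} (univ rs c d) =
  Cₚ-expand (θ′ ⊃ⁿ θ) (gmap _⁻ ⁻-cong rs ◅◅ univ⁻ ◅ nil) d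

-- The second argument may live in a later scope than the first, which is therefore renamed before
-- the two are substituted together.
Cₚ-ƛƛ : (θ₁ θ₂ θ₃ : NfProp) {φ : Term V} {ψ : Term (proof ∷ V)}
  {δ : Proof (proof ∷ proof ∷ V)} →
  (∀ {W} (ρ : Ren V W) (ε₁ ε₂ : Proof W) → Cₚ θ₁ ε₁ → Cₚ θ₂ ε₂ →
    Cₚ θ₃ (sub ((var ∘ ρ) ◂ ε₁ ◂ ε₂) δ)) →
  Cₚ (θ₁ ⊃ⁿ θ₂ ⊃ⁿ θ₃) (ƛₚ φ (ƛₚ ψ δ))
Cₚ-ƛƛ θ₁ θ₂ θ₃ {δ = δ} f = Cₚ-ƛ θ₁ (θ₂ ⊃ⁿ θ₃) λ ρ ε₁ c₁ → Cₚ-ƛ θ₂ θ₃ λ π ε₂ c₂ →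
  subst (Cₚ θ₃) (sym (trans (sub-lift-◂ (var ∘ π) ε₂ ((var ∘ ρ) ◂ ε₁) δ)
      (sub-cong (λ { (here refl) → refl
                   ; (there (here refl)) → sym (rename≡sub π ε₁)
                   ; (there (there x)) → refl }) δ)))
    (f (π ∘ ρ) (rename π ε₁) ε₂ (Cₚ-rename θ₁ π c₁) c₂)

Cₚ-wk² : (θ : NfProp) {δ : Proof V} (ρ : Ren V W) (ε₁ ε₂ : Proof W) → Cₚ θ δ →
  Cₚ θ (sub ((var ∘ ρ) ◂ ε₁ ◂ ε₂) (wk (wk δ)))
Cₚ-wk² θ {δ} ρ ε₁ ε₂ c = subst (Cₚ θ)
  (trans (rename≡sub ρ δ) (sym (trans
    (sub-◂-wk ((var ∘ ρ) ◂ ε₁) ε₂ (wk δ)) (sub-◂-wk (var ∘ ρ) ε₁ δ))))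
  (Cₚ-rename θ ρ c)

Cₚ-postcompose : (θ₁ θ₂ θ₃ : NfProp) {φ ψ : Term V} {δ : Proof V} → Cₚ (θ₂ ⊃ⁿ θ₃) δ →
  Cₚ ((θ₁ ⊃ⁿ θ₂) ⊃ⁿ θ₁ ⊃ⁿ θ₃) (ƛₚ φ (ƛₚ (wk ψ) (wk (wk δ) ∙ (var v₁ ∙ var v₀))))
Cₚ-postcompose θ₁ θ₂ θ₃ c = Cₚ-ƛƛ (θ₁ ⊃ⁿ θ₂) θ₁ θ₃ λ ρ ε₁ ε₂ c₁ c₂ →
  Cₚ-app θ₂ θ₃ (Cₚ-wk² (θ₂ ⊃ⁿ θ₃) ρ ε₁ ε₂ c) (Cₚ-app θ₁ θ₂ c₁ c₂)

Cₚ-precompose : (θ₁ θ₂ θ₃ : NfProp) {φ ψ : Term V} {ε : Proof V} → Cₚ (θ₂ ⊃ⁿ θ₁) ε →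
  Cₚ ((θ₁ ⊃ⁿ θ₃) ⊃ⁿ θ₂ ⊃ⁿ θ₃) (ƛₚ φ (ƛₚ (wk ψ) (var v₁ ∙ (wk (wk ε) ∙ var v₀))))
Cₚ-precompose θ₁ θ₂ θ₃ c = Cₚ-ƛƛ (θ₁ ⊃ⁿ θ₃) θ₂ θ₃ λ ρ ε₁ ε₂ c₁ c₂ →
  Cₚ-app θ₁ θ₃ c₁ (Cₚ-app θ₂ θ₁ (Cₚ-wk² (θ₂ ⊃ⁿ θ₁) ρ ε₁ ε₂ c) c₂)

Cₚ-bicompose : (θ₁ θ₂ θ₃ θ₄ : NfProp) {φ ψ : Term V} {δ ε : Proof V} →
  Cₚ (θ₃ ⊃ⁿ θ₄) δ → Cₚ (θ₂ ⊃ⁿ θ₁) ε →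
  Cₚ ((θ₁ ⊃ⁿ θ₃) ⊃ⁿ θ₂ ⊃ⁿ θ₄)
    (ƛₚ φ (ƛₚ (wk ψ) (wk (wk δ) ∙ (var v₁ ∙ (wk (wk ε) ∙ var v₀)))))
Cₚ-bicompose θ₁ θ₂ θ₃ θ₄ c d = Cₚ-ƛƛ (θ₁ ⊃ⁿ θ₃) θ₂ θ₄ λ ρ ε₁ ε₂ c₁ c₂ →
  Cₚ-app θ₃ θ₄ (Cₚ-wk² (θ₃ ⊃ⁿ θ₄) ρ ε₁ ε₂ c)
    (Cₚ-app θ₁ θ₃ c₁ (Cₚ-app θ₂ θ₁ (Cₚ-wk² (θ₂ ⊃ⁿ θ₁) ρ ε₁ ε₂ d) c₂))

⊃*-↠ : {P P′ Q Q′ : Path V} → P ↠ P′ → Q ↠ Q′ → P ⊃* Q ↠ P′ ⊃* Q′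
⊃*-↠ rs ss = gmap (_⊃* _) ⊃*ˡ rs ◅◅ gmap (_ ⊃*_) ⊃*ʳ ss

-- A neutral side makes the whole path neutral; the remaining four cases are exactly the four
-- contraction rules for ⊃*. Contravariance on the left explains why the forward map of the result
-- uses the backward component of P.
CΩ-⊃* : (θ₁ θ₂ θ₃ θ₄ : NfProp) {P Q : Path V} → CΩ θ₁ θ₂ P → CΩ θ₃ θ₄ Q →
  CΩ (θ₁ ⊃ⁿ θ₃) (θ₂ ⊃ⁿ θ₄) (P ⊃* Q)
CΩ-⊃* _ _ _ _ (neutral rs n) _              = neutral (⊃*-↠ rs nil) (⊃*ˡ n)
CΩ-⊃* _ _ _ _ (ref _ _)      (neutral ss n) = neutral (⊃*-↠ nil ss) (⊃*ʳ n)
CΩ-⊃* _ _ _ _ (univ _ _ _)   (neutral ss n) = neutral (⊃*-↠ nil ss) (⊃*ʳ n)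
CΩ-⊃* _ _ _ _ (ref rs refl)  (ref ss refl)  = ref (⊃*-↠ rs ss ◅◅ ref⊃*ref ◅ nil) refl
CΩ-⊃* θ₁ _ θ₃ θ₄ (ref rs refl) (univ ss c d) = univ (⊃*-↠ rs ss ◅◅ ref⊃*univ ◅ nil)
  (Cₚ-postcompose θ₁ θ₃ θ₄ c) (Cₚ-postcompose θ₁ θ₄ θ₃ d)
CΩ-⊃* θ₁ θ₂ θ₃ _ (univ rs c d) (ref ss refl) = univ (⊃*-↠ rs ss ◅◅ univ⊃*ref ◅ nil)
  (Cₚ-precompose θ₁ θ₂ θ₃ d) (Cₚ-precompose θ₂ θ₁ θ₃ c)
CΩ-⊃* θ₁ θ₂ θ₃ θ₄ (univ rs c d) (univ ss c′ d′) = univ (⊃*-↠ rs ss ◅◅ univ⊃*univ ◅ nil)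
  (Cₚ-bicompose θ₁ θ₂ θ₃ θ₄ c′ d) (Cₚ-bicompose θ₂ θ₁ θ₄ θ₃ d′ c)

C*-⊃* : {φ φ′ ψ ψ′ : Term V} {P Q : Path V} → C* Ω φ φ′ P → C* Ω ψ ψ′ Q →
  C* Ω (φ ⊃ ψ) (φ′ ⊃ ψ′) (P ⊃* Q)
C*-⊃* (θ₁ , θ₂ , r₁ , r₂ , c) (θ₃ , θ₄ , r₃ , r₄ , d) =
  _ , _ , ⊃-↠ r₁ r₃ , ⊃-↠ r₂ r₄ , CΩ-⊃* θ₁ θ₂ θ₃ θ₄ c d

-- Fundamental lemma

C*-ref-Ω : {φ : Term V} → C₀ Ω φ → C* Ω φ φ (ref φ)
C*-ref-Ω (θ , r) = θ , θ , r , r , ref nil refl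

-- Restricted to term variables, the only ones that occur in terms; the induction on terms is
-- thereby independent of the one on proofs and paths.
ComputableTermSub : Ctx V → Sub V W → Set
ComputableTermSub Γ σ = ∀ x → C (typeAt Γ x) (σ x)

ComputableTermSub-rename : (Γ : Ctx V) (π : Ren U W) (σ : Sub V U) →
  ComputableTermSub Γ σ → ComputableTermSub Γ (rename π ∘ σ)
ComputableTermSub-rename Γ π σ s x = C-rename (typeAt Γ x) π (s x)

ComputableTermSub-◂ : {Γ : Ctx V} {A : Ty} {σ : Sub V W} {N : Term W} →
  ComputableTermSub Γ σ → C A N → ComputableTermSub (Γ ▹ ty A) (σ ◂ N)
ComputableTermSub-◂ s c (here refl) = c
ComputableTermSub-◂ s c (there x)   = s x

sub-◂³-liftRen : (M N : Term W) (Q : Path W) (π : Ren V W) (P : Path (path ∷ term ∷ term ∷ V)) →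
  sub (var ◂ M ◂ N ◂ Q) (rename (liftRen (liftRen (liftRen π))) P) ≡
  sub ((var ∘ π) ◂ M ◂ N ◂ Q) P
sub-◂³-liftRen M N Q π P = trans (sub-rename _ _ P) (sub-cong
  (λ { (here refl) → refl ; (there (here refl)) → refl
     ; (there (there (here refl))) → refl ; (there (there (there x))) → refl }) P)

ƛ*-β : (π : Ren V W) {τ : PathSub U V} {ρ σ : Sub U V} (A : Ty) (L : Term (term ∷ U))
  (M N : Term W) (Q : Path W) →
  rename π (ƛ A L ⟦ τ ∶ ρ ∼ σ ⟧) ·⟨ M , N ⟩ Q ⟶
  L ⟦ (rename π ∘ τ) ◂ᵖ Q ∶ (rename π ∘ ρ) ◂ M ∼ (rename π ∘ σ) ◂ N ⟧
ƛ*-β π {τ} {ρ} {σ} A L M N Q = ⟶-≡ β* (trans (sub-◂³-liftRen M N Q π (L ⟦ _ ∶ _ ∼ _ ⟧))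
  (trans (sub³-⟦⟧ (var ∘ π) M N Q {τ} {ρ} {σ} L) (⟦⟧-cong
    (λ { (here refl) → refl ; (there x) → sym (rename≡sub π (τ x)) })
    (λ { (here refl) → refl ; (there x) → sym (rename≡sub π (ρ x)) })
    (λ { (here refl) → refl ; (there x) → sym (rename≡sub π (σ x)) }) L)))

refƛ-β : (π : Ren V W) (σ : Sub U V) (A : Ty) (L : Term (term ∷ U)) (M N : Term W) (Q : Path W) →
  rename π (ref (sub σ (ƛ A L))) ·⟨ M , N ⟩ Q ⟶
  L ⟦ (λ x → rename π (σ x) ⟦⟧) ◂ᵖ Q ∶ (rename π ∘ σ) ◂ M ∼ (rename π ∘ σ) ◂ N ⟧
refƛ-β π σ A L M N Q = ⟶-≡ refƛ (trans
  (cong (_⟦ Q ∶ M ≈ N ⟧) (rename-lift-sub π σ L)) (⟦∶≈⟧-sub (rename π ∘ σ) L Q M N))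

-- Mutual with `⟦⟧-computable`: `C` includes the computability of paths, and a path image of an
-- application contains its argument at both endpoints. The recursion is well founded because the
-- call on an unchanged `ƛ d` goes one way only, and every call back is on a subderivation.
term-computable : {Γ : Ctx V} {M : Term V} {A : Ty} {σ : Sub V W} →
  Γ ⊩ M ∶ A → ComputableTermSub Γ σ → C A (sub σ M)
⟦⟧-computable : {Γ : Ctx V} {M : Term V} {A : Ty} {τ : PathSub V W} {ρ σ : Sub V W} →
  Γ ⊩ M ∶ A → ComputableTermSub Γ ρ → ComputableTermSub Γ σ →
  (∀ x → C* (typeAt Γ x) (ρ x) (σ x) (τ x)) →
  C* A (sub ρ M) (sub σ M) (M ⟦ τ ∶ ρ ∼ σ ⟧)

term-computable (var x refl) s = s x
term-computable bot          s = (⊥ⁿ , nil) , c , c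
  where c = C*-ref-Ω (⊥ⁿ , nil)
term-computable {σ = σ} (_⊃_ {φ} {ψ} c d) s
  with term-computable c s | term-computable d s
... | (θ , r) , c* , _ | (θ′ , r′) , d* , _ =
  (θ ⊃ⁿ θ′ , ⊃-↠ r r′) , C*-⊃* c* d* , C*-ref-Ω (θ ⊃ⁿ θ′ , ⊃-↠ r r′)
-- `C₀` at an arrow returns the full `C`, hence also the computability of `ref (M · N)`. This could
-- not be assembled from `ref M` and `ref N`, whose application is a different path.
term-computable (_·_ {A} {B} c d) s =
  C-app A B (proj₁ (term-computable c s)) (term-computable d s)
term-computable {W = W} {Γ = Γ} {σ = σ} (ƛ {A} {B} {M} d) s =
    (λ ρ N c → C-expand B (ƛ-β ρ σ A M N ◅ nil)
      (term-computable d (ComputableTermSub-◂ (ComputableTermSub-rename Γ ρ σ s) c)))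
  , subst (C* (A ⇒ B) _ _) (sym (⟦⟧₀-sub σ (ƛ A M)))
      -- By `⟦⟧₀-sub` each variable x is sent to `σ x ⟦⟧`, whose computability is the second
      -- component of `C`.
      (⟦⟧-computable (ƛ d) s s λ x → proj₁ (proj₂ (s x)))
  , ref nil , λ {X} ρ N N′ Q c c′ e →
      let sρ : ComputableTermSub Γ (rename ρ ∘ σ)
          sρ = ComputableTermSub-rename Γ ρ σ s
      in C*-expand B (refƛ-β ρ σ A M N N′ Q ◅ nil)
        (C*-≃ B (bwd (ƛ-β ρ σ A M N) ◅ nil) (bwd (ƛ-β ρ σ A M N′) ◅ nil)
          (⟦⟧-computable d (ComputableTermSub-◂ sρ c) (ComputableTermSub-◂ sρ c′)
            λ { (here refl) → e ; (there x) → proj₁ (proj₂ (sρ x)) }))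

⟦⟧-computable (var x refl) r s t = t x
⟦⟧-computable bot          r s t = C*-ref-Ω (⊥ⁿ , nil)
⟦⟧-computable (c ⊃ d)      r s t = C*-⊃* (⟦⟧-computable c r s t) (⟦⟧-computable d r s t)
⟦⟧-computable (_·_ {A} {B} c d) r s t = C*-app A B
  (⟦⟧-computable c r s t) (term-computable d r) (term-computable d s) (⟦⟧-computable d r s t)
⟦⟧-computable {Γ = Γ} {τ = τ} {ρ} {σ} (ƛ {A} {B} {M} d) r s t =
  lam nil , λ π N N′ Q c c′ e → C*-expand B (ƛ*-β π A M N N′ Q ◅ nil)
    (C*-≃ B (bwd (ƛ-β π ρ A M N) ◅ nil) (bwd (ƛ-β π σ A M N′) ◅ nil)
      (⟦⟧-computable d
        (ComputableTermSub-◂ (ComputableTermSub-rename Γ π ρ r) c)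
        (ComputableTermSub-◂ (ComputableTermSub-rename Γ π σ s) c′)
        λ { (here refl) → e ; (there x) → C*-rename (typeAt Γ x) π (t x) }))

Computable : Class V k → Expr V k → Set
Computable (ty A)       M = C A M
Computable (pf φ)       δ = ∃[ θ ] (φ ⇓ θ × Cₚ θ δ)
Computable (M =[ A ] N) P = C* A M N P

Computable-rename : (π : Ren V W) (T : Class V k) {E : Expr V k} →
  Computable T E → Computable (subClass (λ x → var (π x)) T) (rename π E)
Computable-rename π (ty A)       c           = C-rename A π c
Computable-rename π (pf φ)       (θ , r , c) =
  θ , subst (_⇓ θ) (rename≡sub π φ) (⇓-rename π {θ = θ} r) , Cₚ-rename θ π c
Computable-rename π (M =[ A ] N) c           =
  C*-≡ A (rename≡sub π M) (rename≡sub π N) refl (C*-rename A π c)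

subClass-sub : (σ′ : Sub V W) (σ : Sub U V) (T : Class U k) →
  subClass σ′ (subClass σ T) ≡ subClass (λ x → sub σ′ (σ x)) T
subClass-sub σ′ σ (ty A)       = refl
subClass-sub σ′ σ (pf φ)       = cong pf (sub-sub σ′ σ φ)
subClass-sub σ′ σ (M =[ A ] N) = cong₂ _=[ A ]_ (sub-sub σ′ σ M) (sub-sub σ′ σ N)

subClass-cong : {σ σ′ : Sub V W} → σ ≗ σ′ → (T : Class V k) → subClass σ T ≡ subClass σ′ T
subClass-cong eq (ty A)       = refl
subClass-cong eq (pf φ)       = cong pf (sub-cong eq φ)
subClass-cong eq (M =[ A ] N) = cong₂ _=[ A ]_ (sub-cong eq M) (sub-cong eq N)

ComputableSub : Ctx V → Sub V W → Set
ComputableSub {V} Γ σ = ∀ {k} (x : k ∈ V) → Computable (subClass σ (lookup Γ x)) (σ x)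

computableTermSub : (Γ : Ctx V) (σ : Sub V W) → ComputableSub Γ σ → ComputableTermSub Γ σ
computableTermSub Γ σ s x =
  subst (λ T → Computable (subClass σ T) (σ x)) (lookup≡typeAt Γ x) (s x)

ComputableSub-rename : {Γ : Ctx V} {σ : Sub V U} (π : Ren U W) →
  ComputableSub Γ σ → ComputableSub Γ (rename π ∘ σ)
ComputableSub-rename {Γ = Γ} {σ} π s x = subst (λ T → Computable T (rename π (σ x)))
  (trans (subClass-sub (λ x → var (π x)) σ (lookup Γ x))
    (subClass-cong (λ x → sym (rename≡sub π (σ x))) (lookup Γ x)))
  (Computable-rename π (subClass σ (lookup Γ x)) (s x))

ComputableSub-◂ : {Γ : Ctx V} {σ : Sub V W} {F : Expr W l} {T : Class V l} →
  ComputableSub Γ σ → Computable (subClass σ T) F → ComputableSub (Γ ▹ T) (σ ◂ F)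
ComputableSub-◂ {σ = σ} {F} {T} s c (here refl) =
  subst (λ T → Computable T F) (sym (subClass-◂ σ F T)) c
ComputableSub-◂ {Γ = Γ} {σ} {F} s c (there x) =
  subst (λ T → Computable T (σ x)) (sym (subClass-◂ σ F (lookup Γ x))) (s x)

prop-computable : {Γ : Ctx V} {φ : Term V} {σ : Sub V W} →
  Γ ⊩ φ ∶ Ω → ComputableTermSub Γ σ → ∃[ θ ] (sub σ φ ⇓ θ)
prop-computable {σ = σ} c s = proj₁ (term-computable {σ = σ} c s)

computable : {Γ : Ctx V} {E : Expr V k} {T : Class V k} {σ : Sub V W} →
  Γ ⊢ E ∶ T → ComputableSub Γ σ → Computable (subClass σ T) (sub σ E)
computable (⊢var v x)  s = s x
computable {Γ = Γ} {σ = σ} d@(⊢bot _)  s = term-computable {σ = σ} (⊢⇒⊩ d) (computableTermSub Γ σ s)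
computable {Γ = Γ} {σ = σ} d@(⊢⊃ _ _)  s = term-computable {σ = σ} (⊢⇒⊩ d) (computableTermSub Γ σ s)
computable {Γ = Γ} {σ = σ} d@(⊢· _ _)  s = term-computable {σ = σ} (⊢⇒⊩ d) (computableTermSub Γ σ s)
computable {Γ = Γ} {σ = σ} d@(⊢ƛ _)    s = term-computable {σ = σ} (⊢⇒⊩ d) (computableTermSub Γ σ s)
computable (⊢∙ c d)    s with computable c s | computable d s
... | θ , r , c′ | θ₁′ , r′ , d′ with ⇓-⊃⁻¹ θ r
...   | θ₁ , θ₂ , refl , r₁ , r₂ with ⇓-unique {θ = θ₁} {θ₁′} r₁ r′
...     | refl = θ₂ , r₂ , Cₚ-app θ₁ θ₂ c′ d′
computable {V = V} {Γ = Γ} {σ = σ} (⊢ƛₚ {φ = φ} {ψ} {δ} d) s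
  -- The normal forms of φ and ψ are fixed in advance, since the index of the function cannot depend
  -- on the argument it later receives.
  with prop-computable {σ = σ} (proj₂ (wf-⊢ d)) (computableTermSub Γ σ s)
     | prop-computable {σ = σ} (⊩-rename⁻¹ {Γ = Γ} (λ _ → refl) ψ (wfClass-⊢ d))
         (computableTermSub Γ σ s)
... | θ , r | θ′ , r′ = θ ⊃ⁿ θ′ , ⊃-↠ r r′ , lam nil , body
  where
  body : ∀ {X} (ρ : Ren _ X) (ε : Proof X) → Cₚ θ ε → Cₚ θ′ (rename ρ (sub σ (ƛₚ φ δ)) ∙ ε)
  body ρ ε c with computable d (ComputableSub-◂ {Γ = Γ} {T = pf φ} (ComputableSub-rename {Γ = Γ} ρ s)
                   (θ , subst (_⇓ θ) (rename-sub ρ σ φ) (⇓-rename ρ {θ = θ} r) , c))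
  -- The induction hypothesis brings its own normal form of ψ, taken under the extended
  -- substitution; weakening makes that substitution invisible to ψ, so uniqueness identifies θ″
  -- with θ′.
  ... | θ″ , r″ , c′ with ⇓-unique {θ = θ″} {θ′} r″
        (subst (_⇓ θ′) (trans (rename-sub ρ σ ψ) (sym (sub-◂-wk (rename ρ ∘ σ) ε ψ)))
          (⇓-rename ρ {θ = θ′} r′))
  ...   | refl = Cₚ-expand θ′ (⟶-≡ βₚ (trans (cong (_[ ε ]) (rename-lift-sub ρ σ δ))
          (trans (sub-lift-◂ var ε (rename ρ ∘ σ) δ)
            (sub-cong (λ { (here refl) → refl ; (there x) → sub-id (rename ρ (σ x)) }) δ))) ◅ nil) c′
computable {σ = σ} (⊢convₚ c _ eq) s with computable c s
... | θ , r , c′ = θ , ⇓-≃ {θ = θ} (sub-≃ σ eq) r , c′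
computable {Γ = Γ} {σ = σ} (⊢ref d) s =
  proj₂ (proj₂ (term-computable {σ = σ} (⊢⇒⊩ d) (computableTermSub Γ σ s)))
computable (⊢⊃* c d)   s = C*-⊃* (computable c s) (computable d s)
computable (⊢univ c d) s with computable c s | computable d s
-- The two premises normalise φ ⊃ ψ and ψ ⊃ φ independently, so the components have to be matched
-- crosswise.
... | θ , r , c′ | θ′ , r′ , d′ with ⇓-⊃⁻¹ θ r | ⇓-⊃⁻¹ θ′ r′
...   | θ₁ , θ₂ , refl , r₁ , r₂ | θ₃ , θ₄ , refl , r₃ , r₄
      with ⇓-unique {θ = θ₁} {θ₄} r₁ r₄ | ⇓-unique {θ = θ₂} {θ₃} r₂ r₃
...     | refl | refl = θ₁ , θ₂ , r₁ , r₂ , univ nil c′ d′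
computable (⊢⁺ d)      s with computable d s
... | θ , θ′ , r , r′ , c = θ ⊃ⁿ θ′ , ⊃-↠ r r′ , CΩ-⁺ c
computable (⊢⁻ d)      s with computable d s
... | θ , θ′ , r , r′ , c = θ′ ⊃ⁿ θ , ⊃-↠ r′ r , CΩ-⁻ c
computable {Γ = Γ} {σ = σ} (⊢ƛ* {A} {B} {M} {N} {P} d _ _) s = lam nil , λ ρ L L′ Q c c′ e →
  let σ′ = (rename ρ ∘ σ) ◂ L ◂ L′ ◂ Q
      eq : ∀ K → sub σ′ (wk³ K) ≡ rename ρ (sub σ K)
      eq K = trans (sub-rename σ′ _ K) (sym (rename-sub ρ σ K))
      s′ : ComputableSub (Γ ▹ ty A ▹ ty A) ((rename ρ ∘ σ) ◂ L ◂ L′)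
      s′ = ComputableSub-◂ {Γ = Γ ▹ ty A} {T = ty A}
             (ComputableSub-◂ {Γ = Γ} {T = ty A} (ComputableSub-rename {Γ = Γ} ρ s) c) c′
  in C*-≡ B (cong (_· L) (eq M)) (cong (_· L′) (eq N)) refl
    (C*-expand B (⟶-≡ β* (ƛ*-body ρ L L′ Q) ◅ nil)
      (computable d (ComputableSub-◂ {Γ = Γ ▹ ty A ▹ ty A} {T = var v₁ =[ A ] var v₀} s′ e)))
  where
  ƛ*-body : ∀ {X} (ρ : Ren _ X) L L′ Q →
    sub (var ◂ L ◂ L′ ◂ Q) (rename (liftRen (liftRen (liftRen ρ)))
      (sub (liftSub (liftSub (liftSub σ))) P)) ≡ sub ((rename ρ ∘ σ) ◂ L ◂ L′ ◂ Q) P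
  ƛ*-body ρ L L′ Q = trans (sub-◂³-liftRen L L′ Q ρ (sub (liftSub (liftSub (liftSub σ))) P))
    (trans (sub-sub _ (liftSub (liftSub (liftSub σ))) P) (sub-cong
    (λ { (here refl) → refl ; (there (here refl)) → refl
       ; (there (there (here refl))) → refl
       ; (there (there (there x))) → trans
           (sub-◂-wk ((var ∘ ρ) ◂ L ◂ L′) Q (wk (wk (σ x))))
           (trans (sub-◂-wk ((var ∘ ρ) ◂ L) L′ (wk (σ x)))
             (trans (sub-◂-wk (var ∘ ρ) L (σ x)) (sym (rename≡sub ρ (σ x))))) }) P))
computable {Γ = Γ} (⊢·* {A} {B} c d e e′) s = C*-app A B (computable c s)
  (computable e s) (computable e′ s) (computable d s)
computable {σ = σ} (⊢conv* {A} c _ _ eq eq′) s =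
  C*-≃ A (sub-≃ σ eq) (sub-≃ σ eq′) (computable c s)

-- Head normal forms in contexts without term variables

module _ (Γ : Ctx V) (term∉V : term ∉ V) where

  ComputableTermSub-var : ComputableTermSub Γ var
  ComputableTermSub-var x = ⊥-elim (term∉V x)

  -- Proof and path variables are neutral, hence computable as soon as the propositions and
  -- endpoints in their classes are. These are terms without free variables, so the fundamental
  -- lemma applies to them with the vacuous `ComputableTermSub-var`.
  ComputableSub-var : Wf Γ → ComputableSub Γ var
  ComputableSub-var w {term}  x = ⊥-elim (term∉V x)
  ComputableSub-var w {proof} x with lookup Γ x | wfClass-lookup Γ w x
  ... | pf φ | c with prop-computable {σ = var} c ComputableTermSub-var
  ...   | θ , r = θ , r , Cₚ-neutral θ (var x)
  ComputableSub-var w {path}  x with lookup Γ x | wfClass-lookup Γ w x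
  ... | M =[ A ] N | c , c′ = C*-neutral A (var x)
    (proj₁ (term-computable {σ = var} c ComputableTermSub-var))
    (proj₁ (term-computable {σ = var} c′ ComputableTermSub-var))

  computable-id : {E : Expr V k} {T : Class V k} → Γ ⊢ E ∶ T → Computable T E
  computable-id {E = E} {T} d = subst₂ (λ T E → Computable T E) (subClass-id T) (sub-id E)
    (computable d (ComputableSub-var (wf-⊢ d)))

  part₁ : (δ : Proof V) → Γ ⊢ δ ∶ pf bot → ∃[ ν ] (δ ↠ ν × NeutralProof ν)
  part₁ δ d with computable-id d
  ... | ⊥ⁿ , _ , c = c
  ... | _ ⊃ⁿ _ , (() ◅ _) , _

  part₂ : (δ : Proof V) (φ ψ : Term V) → Γ ⊢ δ ∶ pf (φ ⊃ ψ) →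
    (∃[ ν ] (δ ↠ ν × NeutralProof ν))
    ⊎ (∃[ φ′ ] ∃[ ε ] (δ ↠ ƛₚ φ′ ε × φ ≃ φ′ × (Γ ▹ pf φ ⊢ ε ∶ pf (wk ψ))))
  part₂ δ φ ψ d with computable-id d
  ... | θ , r , c with ⇓-⊃⁻¹ θ r
  ...   | _ , _ , refl , _ with proj₁ c | wfClass-⊢ d
  ...     | neutral rs n | _ = inj₁ (_ , rs , n)
  ...     | lam rs | e ⊃ e′ with gen-ƛₚ (⊢-↠ₚ d rs) nil e e′
  ...       | eq , d′ = inj₂ (_ , _ , rs , symmetric _ eq , d′)

  part₃ : (P : Path V) (φ ψ : Term V) → Γ ⊢ P ∶ (φ =[ Ω ] ψ) →
    (∃[ ν ] (P ↠ ν × NeutralPath ν))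
    ⊎ (∃[ χ ] (P ↠ ref χ × φ ≃ ψ × ψ ≃ χ))
    ⊎ (∃[ φ′ ] ∃[ ψ′ ] ∃[ δ ] ∃[ ε ]
        (P ↠ univ φ′ ψ′ δ ε × φ ≃ φ′ × ψ ≃ ψ′
         × (Γ ⊢ δ ∶ pf (φ ⊃ ψ)) × (Γ ⊢ ε ∶ pf (ψ ⊃ φ))))
  part₃ P φ ψ d with computable-id d
  ... | _ , _ , _ , _ , neutral rs n = inj₁ (_ , rs , n)
  ... | _ , _ , _ , _ , ref rs _ with gen-ref (⊢-↠* d rs)
  ...   | _ , eq , eq′ = inj₂ (inj₁ (_ , rs , symmetric _ eq ◅◅ eq′ , symmetric _ eq′))
  part₃ P φ ψ d | _ , _ , _ , _ , univ rs _ _ with gen-univ (⊢-↠* d rs) | wfClass-⊢ d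
  ...   | _ , c , c′ , eq , eq′ | e , e′ = inj₂ (inj₂ (_ , _ , _ , _ , rs
    , symmetric _ eq , symmetric _ eq′
    , ⊢convₚ c (⊩⇒⊢ v (e ⊃ e′)) (⊃-≃ eq eq′) , ⊢convₚ c′ (⊩⇒⊢ v (e′ ⊃ e)) (⊃-≃ eq′ eq)))
    where v = valid-⊢ d

  part₄ : (P : Path V) (M M′ : Term V) (A B : Ty) → Γ ⊢ P ∶ (M =[ A ⇒ B ] M′) →
    (∃[ ν ] (P ↠ ν × NeutralPath ν))
    ⊎ (∃[ N ] (P ↠ ref N × M ≃ M′ × M′ ≃ N))
    ⊎ (∃[ Q ] (P ↠ ƛ* A Q
         × (Γ ▹³ A ⊢ Q ∶ (wk³ M · var v₂ =[ B ] wk³ M′ · var v₁))))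
  part₄ P M M′ A B d with proj₁ (computable-id d)
  ... | neutral rs n = inj₁ (_ , rs , n)
  ... | ref rs with gen-ref (⊢-↠* d rs)
  ...   | _ , eq , eq′ = inj₂ (inj₁ (_ , rs , symmetric _ eq ◅◅ eq′ , symmetric _ eq′))
  part₄ P M M′ A B d | lam rs with gen-ƛ* (⊢-↠* d rs)
  ...   | refl , d′ = inj₂ (inj₂ (_ , rs , d′))

corollary40 : ∀ {V : Scope} (Γ : Ctx V) → term ∉ V →
      (∀ (δ : Proof V) → Γ ⊢ δ ∶ pf bot →
        ∃[ ν ] (δ ↠ ν × NeutralProof ν))
    × (∀ (δ : Proof V) (φ ψ : Term V) → Γ ⊢ δ ∶ pf (φ ⊃ ψ) →
        (∃[ ν ] (δ ↠ ν × NeutralProof ν))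
        ⊎ (∃[ φ′ ] ∃[ ε ] (δ ↠ ƛₚ φ′ ε × φ ≃ φ′ × (Γ ▹ pf φ ⊢ ε ∶ pf (wk ψ)))))
    × (∀ (P : Path V) (φ ψ : Term V) → Γ ⊢ P ∶ (φ =[ Ω ] ψ) →
        (∃[ ν ] (P ↠ ν × NeutralPath ν))
        ⊎ (∃[ χ ] (P ↠ ref χ × φ ≃ ψ × ψ ≃ χ))
        ⊎ (∃[ φ′ ] ∃[ ψ′ ] ∃[ δ ] ∃[ ε ]
            (P ↠ univ φ′ ψ′ δ ε × φ ≃ φ′ × ψ ≃ ψ′
             × (Γ ⊢ δ ∶ pf (φ ⊃ ψ)) × (Γ ⊢ ε ∶ pf (ψ ⊃ φ)))))
    × (∀ (P : Path V) (M M′ : Term V) (A B : Ty) → Γ ⊢ P ∶ (M =[ A ⇒ B ] M′) →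
        (∃[ ν ] (P ↠ ν × NeutralPath ν))
        ⊎ (∃[ N ] (P ↠ ref N × M ≃ M′ × M′ ≃ N))
        ⊎ (∃[ Q ] (P ↠ ƛ* A Q
             × (Γ ▹³ A ⊢ Q ∶ (wk³ M · var v₂ =[ B ] wk³ M′ · var v₁)))))
corollary40 Γ t = part₁ Γ t , part₂ Γ t , part₃ Γ t , part₄ Γ t
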